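{- Let $G$ be a finite simple graph with $\operatorname{Mad}(G) < \frac{5}{2}$. Then $\chi_s(G) \le 4$.
   Context: All graphs are finite and simple. The maximum average degree of $G$ is $\operatorname{Mad}(G) = \max_{H \subseteq G} \frac{2|E(H)|}{|V(H)|}$, the maximum over nonempty subgraphs $H$ of $G$. A star $k$-coloring of $G$ is a proper vertex coloring $c: V(G) \to \{1,\dots,k\}$ such that for any two colors, the subgraph induced by the vertices receiving those two colors is a forest each of whose components is a star. The star chromatic number $\chi_s(G)$ is the minimum $k$ such that $G$ has a star $k$-coloring. -}

module Defs where

open import Data.Nat using (ℕ; zero; suc; _+_; _*_; _<_; _≤_; _<ᵇ_)
open import Data.Bool using (Bool; true; false; _∧_; if_then_else_)
open import Data.Fin using (Fin; toℕ)
open import Data.Product using (_×_; Σ; ∃)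
open import Data.Sum using (_⊎_)
open import Relation.Binary.PropositionalEquality using (_≡_; _≢_)
import Data.Fin
import Relation.Nullary

record Graph : Set where
  field
    n      : ℕ
    adj    : Fin n → Fin n → Bool
    sym    : ∀ i j → adj i j ≡ adj j i
    irrefl : ∀ i → adj i i ≡ false
open Graph public

count : ∀ {m} → (Fin m → Bool) → ℕ
count {zero}  p = 0
count {suc m} p = (if p Fin.zero then 1 else 0) + count {m} (λ i → p (Fin.suc i))

record Subgraph (G : Graph) : Set where
  field
    vs     : Fin (n G) → Bool
    es     : Fin (n G) → Fin (n G) → Bool
    es-sub : ∀ i j → es i j ≡ true →
             (adj G i j ≡ true) × (vs i ≡ true) × (vs j ≡ true)
open Subgraph public

nV : ∀ {G} → Subgraph G → ℕ
nV H = count (vs H)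

-- |E(H)| : unordered edges {i,j}, counted once via toℕ i < toℕ j
-- (edge set of H read off as es i j for i < j)
nE : ∀ {G} → Subgraph G → ℕ
nE {G} H = sumF (λ i → count (λ j → (toℕ i <ᵇ toℕ j) ∧ es H i j))
  where
  sumF : ∀ {m} → (Fin m → ℕ) → ℕ
  sumF {zero}  f = 0
  sumF {suc m} f = f Fin.zero + sumF (λ i → f (Fin.suc i))

-- Mad(G) < 5/2, i.e. for every nonempty subgraph H,
-- 2|E(H)|/|V(H)| < 5/2, equivalently (|V(H)| > 0) 4|E(H)| < 5|V(H)|.
MadLessFiveHalves : Graph → Set
MadLessFiveHalves G = ∀ (H : Subgraph G) → 1 ≤ nV H → 4 * nE H < 5 * nV H

data Reach (G : Graph) (P : Fin (n G) → Bool) : Fin (n G) → Fin (n G) → Set where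
  here : ∀ {x} → Reach G P x x
  step : ∀ {x y z} → adj G x y ≡ true → P y ≡ true → Reach G P y z → Reach G P x z

-- The subgraph of G induced by P is a forest each of whose components is a
-- star: for every vertex v of it, its component C contains a centre z such
-- that every other vertex of C is adjacent to z and every edge of C is
-- incident to z (i.e. C is a star K_{1,t}, t ≥ 0, in particular a tree).
InducedStarForest : (G : Graph) → (Fin (n G) → Bool) → Set
InducedStarForest G P =
  ∀ v → P v ≡ true →
  Σ (Fin (n G)) λ z → Reach G P v z ×
    (∀ x → Reach G P v x → x ≢ z → adj G z x ≡ true) ×
    (∀ x y → Reach G P v x → Reach G P v y → adj G x y ≡ true → (x ≡ z) ⊎ (y ≡ z))

twoColoured : ∀ {m k} → (Fin m → Fin k) → Fin k → Fin k → Fin m → Bool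
twoColoured c a b v with Data.Fin._≟_ (c v) a | Data.Fin._≟_ (c v) b
... | Relation.Nullary.yes _ | _ = true
... | Relation.Nullary.no _  | Relation.Nullary.yes _ = true
... | Relation.Nullary.no _  | Relation.Nullary.no _  = false

IsStarColouring : (G : Graph) (k : ℕ) → (Fin (n G) → Fin k) → Set
IsStarColouring G k c =
  (∀ i j → adj G i j ≡ true → c i ≢ c j) ×
  (∀ a b → InducedStarForest G (twoColoured c a b))

StarChromaticAtMost : Graph → ℕ → Set
StarChromaticAtMost G k = Σ (Fin (n G) → Fin k) (IsStarColouring G k)

{-# OPTIONS --safe #-}

-- Mad(G) < 5/2 yields a partition of the vertices into a set I whose members
-- are at distance at least 3 from each other and a set F inducing a forest.
-- Colouring F by depth modulo 3 and I with a fourth colour is a star colouring: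
-- a two-coloured path on four vertices would give a vertex two neighbours in I,
-- or two parents in the forest.
--
-- The partition is found for graphs whose vertices have a type U, F or N
-- (weights 5, 4, 2), under the hypothesis that the potential
-- ρ(S) = w(S) − 4|E(S)| is positive on nonempty sets.  In a minimal
-- counterexample every proper nonempty set S has ρ(S) ≥ 2 (otherwise colour S,
-- contract its forest part to a vertex of type N, and colour the rest) and sends
-- out at least two edges.  Call a vertex of degree 2 thin if its type is not N.
-- No thin vertex of type U has two thin neighbours, and no vertex of type U and
-- degree at least 3 has only neighbours of type U and degree 2.  Each vertex now
-- sends charge to the neighbours of type U and degree 2.  A vertex can only be
-- overcharged if it has degree 3, and then it lies in a proper set with ρ = 2.
-- By submodularity these tight sets may be merged into disjoint ones, and each
-- of them has charge to spare because of its two outgoing edges.  Summing up,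
-- ρ(V) ≤ 0, a contradiction.

module Submission where

open import Data.Bool using (Bool; true; false; _∧_; if_then_else_)
open import Data.Bool.Properties using () renaming (_≟_ to _≟ᴮ_)
open import Data.Empty using (⊥; ⊥-elim)
open import Data.Fin using (Fin; zero; suc; toℕ; fromℕ; inject₁; finToFun; funToFin; _≟_)
open import Data.Fin.Properties using (all?; any?; toℕ-injective; inject₁-injective; fromℕ≢inject₁; finToFun-funToFin)
open import Data.List using (_∷_; []; allFin)
open import Data.List.Membership.Propositional.Properties using (∈-allFin)
open import Data.List.Relation.Unary.All as All using (All)
open import Data.Nat using (ℕ; zero; suc; _+_; _*_; _∸_; _^_; _≤_; _<_; _<ᵇ_; _≤?_; z≤n; s≤s) renaming (_≟_ to _≟ᴺ_)
open import Data.Nat.Properties hiding (_≟_)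
open import Data.Nat.Tactic.RingSolver using (solve)
open import Data.Product using (Σ; ∃; _×_; _,_; proj₁; proj₂)
open import Data.Sum using (_⊎_; inj₁; inj₂; [_,_]′; map₂)
open import Relation.Binary using (tri<; tri≈; tri>)
open import Relation.Binary.PropositionalEquality using (_≡_; _≢_; refl; sym; trans; cong; cong₂; subst; module ≡-Reasoning)
open import Relation.Nullary using (¬_; Dec; yes; no)
open import Relation.Nullary.Decidable using (_×-dec_; _⊎-dec_; _→-dec_; ¬?)
import Algebra.Properties.Semiring.Sum +-*-semiring as Sum
open import Defs using (Graph; module Graph; adj; count; Subgraph; nV; nE; MadLessFiveHalves; Reach; here; step; InducedStarForest; twoColoured; IsStarColouring; StarChromaticAtMost)

-- The types let pieces be coloured separately: a vertex facing another piece is told beforehand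
-- what to avoid, and the potential pays for it. The weight 5 comes from the density bound 5|V| >
-- 4|E|. An edge to a removed set is worth 4 to the set that stays. Lowering U to F costs 1,
-- lowering any vertex to N at most 3. So marking a neighbour of `I` in a collapsed set as N spends
-- at most 3 of the 4 units of the removed edge, and marking an end of a single cut edge as F spends
-- the one unit by which a potential of 2 exceeds the required 1. The obstacle is the path reduction
-- at a vertex of degree 3, which a set of potential exactly 2 may block. Such a set cannot be
-- reduced further, so the charge is balanced over it as a whole instead of vertex by vertex.
-- Minimality is a classical argument: the induction concludes `¬ ¬ Col`, and the double negation is
-- removed once, at the very end, by a finite search.

-- Linear arithmetic

infixl 6 _⊞_
infixr 7 _⊠_

_⊞_ : ∀ {a b c d} → a ≤ b → c ≤ d → a + c ≤ b + d
_⊞_ = +-mono-≤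

_⊠_ : ∀ k {a b} → a ≤ b → k * a ≤ k * b
_⊠_ = *-monoʳ-≤

-- Here a ≤ b is to be a linear combination of hypotheses; the ring solver then
-- checks that it implies p ≤ q with slack s.
lin : ∀ {a b p q} s → a ≤ b → p + b + s ≡ q + a → p ≤ q
lin {a} {b} {p} {q} s h e =
  +-cancelʳ-≤ a p q (≤-trans (+-monoʳ-≤ p h) (≤-trans (m≤m+n (p + b) s) (≤-reflexive e)))

absurd-lin : ∀ {a b} {ℓ} {A : Set ℓ} s → a ≤ b → 1 + b + s ≡ a → A
absurd-lin {a} {b} s h e = ⊥-elim (1+n≰n (≤-trans (≤-trans (m≤m+n (1 + b) s) (≤-reflexive e)) h))

-- Subsets of Fin n as functions with values in {0 , 1}

Pt : ℕ → Set
Pt n = Fin n → ℕ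

private variable n : ℕ

infix 4 _⊑_
infixl 6 _⊕_ _∖_
infixl 7 _⊓_

_⊑_ : Pt n → Pt n → Set
X ⊑ Y = ∀ i → X i ≤ Y i

_⊕_ _∖_ _⊓_ : Pt n → Pt n → Pt n
(X ⊕ Y) i = X i + Y i
(X ∖ Y) i = X i ∸ Y i
(X ⊓ Y) i = X i * Y i

∅ full : Pt n
∅ i = 0
full i = 1

-- A separate hypothesis, because `Pt` also holds weights and counts. `Bit (X ⊕ Y)` encodes that the
-- sets `X` and `Y` are disjoint, with union `X ⊕ Y`.
Bit : Pt n → Set
Bit X = X ⊑ full

bit : ∀ {k} → k ≤ 1 → k ≡ 0 ⊎ k ≡ 1
bit z≤n = inj₁ refl
bit (s≤s z≤n) = inj₂ refl

1≢0 : ∀ {k} {ℓ} {A : Set ℓ} → k ≡ 1 → k ≡ 0 → A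
1≢0 refl ()

⊑-trans : {X Y Z : Pt n} → X ⊑ Y → Y ⊑ Z → X ⊑ Z
⊑-trans p q i = ≤-trans (p i) (q i)

∖-⊑ : (X Y : Pt n) → (X ∖ Y) ⊑ X
∖-⊑ X Y i = m∸n≤m (X i) (Y i)

split : {X Y : Pt n} → Y ⊑ X → ∀ i → X i ≡ (Y ⊕ (X ∖ Y)) i
split p i = sym (m+[n∸m]≡n (p i))

⊑1 : {X Y : Pt n} → X ⊑ Y → Bit Y → ∀ {i} → X i ≡ 1 → Y i ≡ 1
⊑1 {X = X} {Y} p b {i} x = ≤-antisym (b i) (≤-trans (≤-reflexive (sym x)) (p i))

⊑0 : {X Y : Pt n} → X ⊑ Y → ∀ {i} → Y i ≡ 0 → X i ≡ 0
⊑0 {X = X} p {i} y = n≤0⇒n≡0 (≤-trans (p i) (≤-reflexive y))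

∈-⊕ : ∀ {a b} → a + b ≡ 1 → a ≡ 1 ⊎ b ≡ 1
∈-⊕ {zero} h = inj₂ h
∈-⊕ {suc zero} h = inj₁ refl

∈-∖ : {X Y : Pt n} → Bit X → ∀ {i} → (X ∖ Y) i ≡ 1 → X i ≡ 1 × Y i ≡ 0
∈-∖ {X = X} {Y} b {i} h with bit (b i)
... | inj₁ q = 1≢0 h (trans (cong (_∸ Y i) q) (0∸n≡0 (Y i)))
... | inj₂ q = q , go (trans (cong (_∸ Y i) (sym q)) h)
  where
  go : ∀ {k} → 1 ∸ k ≡ 1 → k ≡ 0
  go {zero} h = refl
  go {suc k} h = ⊥-elim (0≢1+n (trans (sym (0∸n≡0 k)) h))

∈-∖⁺ : {X Y : Pt n} → ∀ {i} → X i ≡ 1 → Y i ≡ 0 → (X ∖ Y) i ≡ 1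
∈-∖⁺ p q = cong₂ _∸_ p q

∈-split : {X Y : Pt n} → Y ⊑ X → ∀ {i} → X i ≡ 1 → Y i ≡ 1 ⊎ (X ∖ Y) i ≡ 1
∈-split p {i} h = ∈-⊕ (trans (sym (split p i)) h)

-- For gluing: when two disjoint pieces are coloured separately, the forest part of the whole falls
-- into the union of their forest parts. The inclusions keep the truncated subtraction exact.
⊕-∖ : {A R I J : Pt n} → I ⊑ A → J ⊑ R → (A ⊕ R) ∖ (I ⊕ J) ⊑ (A ∖ I) ⊕ (R ∖ J)
⊕-∖ {A = A} {R} {I} {J} p q i = ≤-reflexive (begin
  A i + R i ∸ (I i + J i)                                 ≡⟨ cong (_∸ (I i + J i)) (cong₂ _+_ (split p i) (split q i)) ⟩
  I i + (A i ∸ I i) + (J i + (R i ∸ J i)) ∸ (I i + J i)   ≡⟨ cong (_∸ (I i + J i)) (regroup (I i) (A i ∸ I i) (J i) (R i ∸ J i)) ⟩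
  I i + J i + ((A i ∸ I i) + (R i ∸ J i)) ∸ (I i + J i)   ≡⟨ m+n∸m≡n (I i + J i) _ ⟩
  (A i ∸ I i) + (R i ∸ J i)                               ∎)
  where
  open ≡-Reasoning
  regroup : ∀ a b c d → a + b + (c + d) ≡ a + c + (b + d)
  regroup a b c d = solve (a ∷ b ∷ c ∷ d ∷ [])

⊓-⊑ˡ : {X Y : Pt n} → Bit Y → (X ⊓ Y) ⊑ X
⊓-⊑ˡ {X = X} b i = ≤-trans (*-monoʳ-≤ (X i) (b i)) (≤-reflexive (*-identityʳ (X i)))

⊓-⊑ʳ : {X Y : Pt n} → Bit X → (X ⊓ Y) ⊑ Y
⊓-⊑ʳ {Y = Y} b i = ≤-trans (*-monoˡ-≤ (Y i) (b i)) (≤-reflexive (*-identityˡ (Y i)))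

opaque
  δ : Fin n → Pt n
  δ x i with x ≟ i
  ... | yes _ = 1
  ... | no _ = 0

  δ-self : (x : Fin n) → δ x x ≡ 1
  δ-self x with x ≟ x
  ... | yes _ = refl
  ... | no ne = ⊥-elim (ne refl)

  δ-other : {x y : Fin n} → x ≢ y → δ x y ≡ 0
  δ-other {x = x} {y} ne with x ≟ y
  ... | yes e = ⊥-elim (ne e)
  ... | no _ = refl

  δ-bit : (x : Fin n) → Bit (δ x)
  δ-bit x i with x ≟ i
  ... | yes _ = s≤s z≤n
  ... | no _ = z≤n

  δ1 : {x y : Fin n} → δ x y ≡ 1 → x ≡ y
  δ1 {x = x} {y} e with x ≟ y
  ... | yes p = p

  δ-⊑ : {X : Pt n} {x : Fin n} → X x ≡ 1 → δ x ⊑ X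
  δ-⊑ {x = x} h i with x ≟ i
  ... | yes refl = ≤-reflexive (sym h)
  ... | no _ = z≤n

-- Weighted sums and bilinear forms

-- Opaque, so that unification can recover f and X from dot f X.
opaque
  dot : Pt n → Pt n → ℕ
  dot f X = Sum.sum (f ⊓ X)

size : Pt n → ℕ
size = dot full

opaque
  unfolding dot

  dot-size : (f X : Pt n) → dot f X ≡ size (f ⊓ X)
  dot-size f X = Sum.sum-cong-≗ λ i → sym (+-identityʳ (f i * X i))

form : (Fin n → Pt n) → Pt n → Pt n → ℕ
form m X Y = dot (λ i → dot (m i) Y) X

opaque
  unfolding dot

  dot-cong : {f g X Y : Pt n} → (∀ i → f i ≡ g i) → (∀ i → X i ≡ Y i) → dot f X ≡ dot g Y
  dot-cong p q = Sum.sum-cong-≗ λ i → cong₂ _*_ (p i) (q i)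

dot-congʳ : (f : Pt n) {X Y : Pt n} → (∀ i → X i ≡ Y i) → dot f X ≡ dot f Y
dot-congʳ f = dot-cong (λ _ → refl)

opaque
  unfolding dot

  dot-comm : (f X : Pt n) → dot f X ≡ dot X f
  dot-comm f X = Sum.sum-cong-≗ λ i → *-comm (f i) (X i)

  dot-⊓ : (f g X : Pt n) → dot (f ⊓ g) X ≡ dot f (g ⊓ X)
  dot-⊓ f g X = Sum.sum-cong-≗ λ i → *-assoc (f i) (g i) (X i)

  dot-⊕ : (f X Y : Pt n) → dot f (X ⊕ Y) ≡ dot f X + dot f Y
  dot-⊕ f X Y = trans (Sum.sum-cong-≗ λ i → *-distribˡ-+ (f i) (X i) (Y i)) (Sum.∑-distrib-+ (f ⊓ X) (f ⊓ Y))

  dot-⊕ˡ : (f g X : Pt n) → dot (f ⊕ g) X ≡ dot f X + dot g X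
  dot-⊕ˡ f g X = trans (Sum.sum-cong-≗ λ i → *-distribʳ-+ (X i) (f i) (g i)) (Sum.∑-distrib-+ (f ⊓ X) (g ⊓ X))

  dot-scale : ∀ c (f X : Pt n) → dot (λ i → c * f i) X ≡ c * dot f X
  dot-scale c f X = trans (Sum.sum-cong-≗ λ i → *-assoc c (f i) (X i)) (sym (Sum.*-distribˡ-sum c (f ⊓ X)))

sum-mono : {f g : Pt n} → f ⊑ g → Sum.sum f ≤ Sum.sum g
sum-mono {zero} p = z≤n
sum-mono {suc n} p = +-mono-≤ (p zero) (sum-mono λ i → p (suc i))

opaque
  unfolding dot

  dot-mono : {f g X Y : Pt n} → f ⊑ g → X ⊑ Y → dot f X ≤ dot g Y
  dot-mono p q = sum-mono λ i → *-mono-≤ (p i) (q i)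

dot-monoʳ : (f : Pt n) {X Y : Pt n} → X ⊑ Y → dot f X ≤ dot f Y
dot-monoʳ f = dot-mono (λ _ → ≤-refl)

opaque
  unfolding dot

  dot-≤ : {f g X : Pt n} → Bit X → (∀ i → X i ≡ 1 → f i ≤ g i) → dot f X ≤ dot g X
  dot-≤ {f = f} {g} {X} b h = sum-mono λ i → go i (bit (b i))
    where
    go : ∀ i → X i ≡ 0 ⊎ X i ≡ 1 → f i * X i ≤ g i * X i
    go i (inj₁ e) rewrite e | *-zeroʳ (f i) = z≤n
    go i (inj₂ e) = *-monoˡ-≤ (X i) (h i e)

dot-≡ : {f g X : Pt n} → Bit X → (∀ i → X i ≡ 1 → f i ≡ g i) → dot f X ≡ dot g X
dot-≡ b h = ≤-antisym (dot-≤ b λ i e → ≤-reflexive (h i e)) (dot-≤ b λ i e → ≤-reflexive (sym (h i e)))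

dot-const : ∀ c {f X : Pt n} → Bit X → (∀ i → X i ≡ 1 → f i ≤ c) → dot f X ≤ c * size X
dot-const c {f} {X} b h =
  ≤-trans (dot-≤ b λ i e → ≤-trans (h i e) (≤-reflexive (sym (*-identityʳ c)))) (≤-reflexive (dot-scale c full X))

opaque
  unfolding dot

  dot-∅ : (f : Pt n) → dot f ∅ ≡ 0
  dot-∅ {n} f = trans (Sum.sum-cong-≗ λ i → *-zeroʳ (f i)) (Sum.sum-replicate-zero n)

dot-zeroˡ : {f X : Pt n} → Bit X → (∀ i → X i ≡ 1 → f i ≡ 0) → dot f X ≡ 0
dot-zeroˡ b h = n≤0⇒n≡0 (dot-const 0 b λ i e → ≤-reflexive (h i e))

opaque
  unfolding dot δ

  dot-δ : (f : Pt n) (x : Fin n) → dot f (δ x) ≡ f x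
  dot-δ {suc n} f zero =
    trans (cong₂ _+_ (*-identityʳ (f zero)) (trans (Sum.sum-cong-≗ λ i → *-zeroʳ (f (suc i))) (Sum.sum-replicate-zero n)))
          (+-identityʳ (f zero))
  dot-δ {suc n} f (suc x) =
    trans (cong₂ _+_ (*-zeroʳ (f zero)) (Sum.sum-cong-≗ λ i → cong (f (suc i) *_) (δ-suc x i))) (dot-δ (λ i → f (suc i)) x)
    where
    δ-suc : (x i : Fin n) → δ (suc x) (suc i) ≡ δ x i
    δ-suc x i with x ≟ i
    ... | yes _ = refl
    ... | no _ = refl

dot-δˡ : (X : Pt n) (x : Fin n) → dot (δ x) X ≡ X x
dot-δˡ X x = trans (dot-comm (δ x) X) (dot-δ X x)

dot-split : (f : Pt n) {X Y : Pt n} → Y ⊑ X → dot f X ≡ dot f Y + dot f (X ∖ Y)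
dot-split f {X} {Y} p = trans (dot-congʳ f (split p)) (dot-⊕ f Y (X ∖ Y))

term≤dot : (f : Pt n) {X : Pt n} {x : Fin n} → X x ≡ 1 → f x ≤ dot f X
term≤dot f {X} {x} h = ≤-trans (≤-reflexive (sym (dot-δ f x))) (dot-monoʳ f (δ-⊑ h))

opaque
  unfolding dot

  dot≥1 : {f X : Pt n} → Bit X → 1 ≤ dot f X → ∃ λ x → X x ≡ 1 × 1 ≤ f x
  dot≥1 {f = f} {X} b h with any? (λ x → 1 ≤? f x * X x)
  ... | yes (x , p) with bit (b x)
  ...   | inj₁ e = ⊥-elim (1+n≰n (≤-trans p (≤-reflexive (trans (cong (f x *_) e) (*-zeroʳ (f x))))))
  ...   | inj₂ e = x , e , ≤-trans p (≤-reflexive (trans (cong (f x *_) e) (*-identityʳ (f x))))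
  dot≥1 {n = n} {f = f} {X} b h | no np =
    ⊥-elim (1+n≰n (≤-trans h (≤-trans (sum-mono λ i → ≮⇒≥ (λ q → np (i , q))) (≤-reflexive (Sum.sum-replicate-zero n)))))

dot≡0 : {f X : Pt n} → dot f X ≡ 0 → ∀ {x} → X x ≡ 1 → f x ≡ 0
dot≡0 {f = f} e h = n≤0⇒n≡0 (≤-trans (term≤dot f h) (≤-reflexive e))

opaque
  unfolding dot

  -- Double counting of weighted pairs. It makes `B` symmetric and later equates charge sent with
  -- charge received.
  dot-swap : (m : Fin n → Pt n) (X Y : Pt n) → form m X Y ≡ form (λ j i → m i j) Y X
  dot-swap m X Y = begin
    Sum.sum (λ i → Sum.sum (λ j → m i j * Y j) * X i)
      ≡⟨ Sum.sum-cong-≗ (λ i → Sum.*-distribʳ-sum (X i) (λ j → m i j * Y j)) ⟩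
    Sum.sum (λ i → Sum.sum (λ j → m i j * Y j * X i))
      ≡⟨ Sum.∑-comm (λ i j → m i j * Y j * X i) ⟩
    Sum.sum (λ j → Sum.sum (λ i → m i j * Y j * X i))
      ≡⟨ Sum.sum-cong-≗ (λ j → Sum.sum-cong-≗ λ i → rot (m i j) (Y j) (X i)) ⟩
    Sum.sum (λ j → Sum.sum (λ i → m i j * X i * Y j))
      ≡⟨ Sum.sum-cong-≗ (λ j → Sum.*-distribʳ-sum (Y j) (λ i → m i j * X i)) ⟨
    Sum.sum (λ j → Sum.sum (λ i → m i j * X i) * Y j) ∎
    where
    open ≡-Reasoning
    rot : ∀ a b c → a * b * c ≡ a * c * b
    rot a b c = solve (a ∷ b ∷ c ∷ [])

form-⊕ʳ : (m : Fin n → Pt n) (X Y Z : Pt n) → form m X (Y ⊕ Z) ≡ form m X Y + form m X Z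
form-⊕ʳ m X Y Z =
  trans (dot-cong (λ i → dot-⊕ (m i) Y Z) (λ _ → refl)) (dot-⊕ˡ (λ i → dot (m i) Y) (λ i → dot (m i) Z) X)

form-⊕ˡ : (m : Fin n → Pt n) (X Y Z : Pt n) → form m (X ⊕ Y) Z ≡ form m X Z + form m Y Z
form-⊕ˡ m X Y Z = dot-⊕ (λ i → dot (m i) Z) X Y

form-cong : (m : Fin n → Pt n) {X X′ Y Y′ : Pt n} → (∀ i → X i ≡ X′ i) → (∀ i → Y i ≡ Y′ i) → form m X Y ≡ form m X′ Y′
form-cong m p q = dot-cong (λ i → dot-congʳ (m i) q) p

form-mono : (m : Fin n → Pt n) {X X′ Y Y′ : Pt n} → X ⊑ X′ → Y ⊑ Y′ → form m X Y ≤ form m X′ Y′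
form-mono m p q = dot-mono (λ i → dot-monoʳ (m i) q) p

size-δ : (x : Fin n) → size (δ x) ≡ 1
size-δ x = dot-δ full x

size≥1 : {X : Pt n} {x : Fin n} → X x ≡ 1 → 1 ≤ size X
size≥1 h = term≤dot full h

size≥1⇒ : {X : Pt n} → Bit X → 1 ≤ size X → ∃ λ x → X x ≡ 1
size≥1⇒ b h with dot≥1 {f = full} b h
... | x , e , _ = x , e

size≡0 : {X : Pt n} → Bit X → size X ≡ 0 → ∀ i → X i ≡ 0
size≡0 {X = X} b e i with bit (b i)
... | inj₁ q = q
... | inj₂ q = ⊥-elim (1+n≰n (≤-trans (size≥1 {X = X} q) (≤-reflexive e)))

Empty? : {X : Pt n} → Bit X → (∀ i → X i ≡ 0) ⊎ ∃ λ x → X x ≡ 1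
Empty? {X = X} b with 1 ≤? size X
... | yes p = inj₂ (size≥1⇒ b p)
... | no p = inj₁ (size≡0 b (n<1⇒n≡0 (≰⇒> p)))

-- Graphs whose vertices carry a type

record Adj (n : ℕ) : Set where
  field
    e     : Fin n → Pt n
    e-bit : ∀ i → Bit (e i)
    e-sym : ∀ i j → e i j ≡ e j i
    e-irr : ∀ i → e i i ≡ 0

-- In a partition into a sparse set I and a forest F, a vertex of type F has to
-- go to F, and a vertex of type N moreover has no neighbour in I.
data Ty : Set where
  U F N : Ty

-- If all types are U then W t S − 2 D S is 5|V(S)| − 4|E(S)|.
w : Ty → ℕ
w U = 5
w F = 4
w N = 2

2≤w : ∀ τ → 2 ≤ w τ
2≤w U = m≤m+n 2 3
2≤w F = m≤m+n 2 2
2≤w N = ≤-refl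

w≤5 : ∀ τ → w τ ≤ 5
w≤5 U = ≤-refl
w≤5 F = n≤1+n 4
w≤5 N = m≤m+n 2 3

W : (Fin n → Ty) → Pt n → ℕ
W t = dot (λ i → w (t i))

-- The number will be that of the neighbours in a set coloured separately; only whether it is zero
-- matters. The loss of weight is then bounded by 1 or 3 times this number, so that over a set it
-- adds up to a multiple of an edge count.
forceF forceN : ℕ → Ty → Ty
forceF zero τ = τ
forceF (suc k) U = F
forceF (suc k) τ = τ
forceN zero τ = τ
forceN (suc k) τ = N

w-forceF : ∀ k τ → w τ ≤ w (forceF k τ) + k
w-forceF zero τ = m≤m+n (w τ) 0
w-forceF (suc k) U = ≤-trans (m≤m+n 5 k) (≤-reflexive (sym (+-suc 4 k)))
w-forceF (suc k) F = m≤m+n 4 (suc k)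
w-forceF (suc k) N = m≤m+n 2 (suc k)

w-forceN : ∀ k τ → w τ ≤ w (forceN k τ) + 3 * k
w-forceN zero τ = m≤m+n (w τ) 0
w-forceN (suc k) τ = ≤-trans (w≤5 τ) (+-monoʳ-≤ 2 (*-monoʳ-≤ 3 {1} {suc k} (s≤s z≤n)))

forceF-U : ∀ k {τ} → forceF k τ ≡ U → k ≡ 0 × τ ≡ U
forceF-U zero e = refl , e
forceF-U (suc k) {U} ()
forceF-U (suc k) {F} ()
forceF-U (suc k) {N} ()

forceF-N : ∀ k {τ} → τ ≡ N → forceF k τ ≡ N
forceF-N zero refl = refl
forceF-N (suc k) refl = refl

forceN-U : ∀ k {τ} → forceN k τ ≡ U → k ≡ 0 × τ ≡ U
forceN-U zero e = refl , e
forceN-U (suc k) ()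

forceN-N : ∀ k {τ} → τ ≡ N → forceN k τ ≡ N
forceN-N zero e = e
forceN-N (suc k) e = refl

forceN-≥1 : ∀ {k} τ → 1 ≤ k → forceN k τ ≡ N
forceN-≥1 {suc k} τ h = refl

-- Edge counts, potential, forests and partitions

module Net {n} (G : Adj n) where
  open Adj G public

  row : Fin n → Pt n → ℕ
  row x = dot (e x)

  B : Pt n → Pt n → ℕ
  B = form e

  -- Twice the number of edges inside X.
  D : Pt n → ℕ
  D X = B X X

  B-comm : ∀ X Y → B X Y ≡ B Y X
  B-comm X Y = trans (dot-swap e X Y) (dot-cong (λ i → dot-cong (λ j → e-sym j i) (λ _ → refl)) (λ _ → refl))

  B-δˡ : ∀ x Y → B (δ x) Y ≡ row x Y
  B-δˡ x Y = dot-δ (λ i → row i Y) x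

  B-δʳ : ∀ X y → B X (δ y) ≡ row y X
  B-δʳ X y = trans (B-comm X (δ y)) (B-δˡ y X)

  row-δ : ∀ x y → row x (δ y) ≡ e x y
  row-δ x y = dot-δ (e x) y

  D-δ : ∀ x → D (δ x) ≡ 0
  D-δ x = trans (B-δˡ x (δ x)) (trans (row-δ x x) (e-irr x))

  D-⊕ : ∀ X Y → D (X ⊕ Y) ≡ D X + D Y + 2 * B X Y
  D-⊕ X Y = begin
    B (X ⊕ Y) (X ⊕ Y)                     ≡⟨ form-⊕ˡ e X Y (X ⊕ Y) ⟩
    B X (X ⊕ Y) + B Y (X ⊕ Y)             ≡⟨ cong₂ _+_ (form-⊕ʳ e X X Y) (form-⊕ʳ e Y X Y) ⟩
    (D X + B X Y) + (B Y X + D Y)         ≡⟨ cong (λ z → (D X + B X Y) + (z + D Y)) (B-comm Y X) ⟩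
    (D X + B X Y) + (B X Y + D Y)         ≡⟨ regroup (D X) (D Y) (B X Y) ⟩
    D X + D Y + 2 * B X Y                 ∎
    where
    open ≡-Reasoning
    regroup : ∀ a b c → (a + c) + (c + b) ≡ a + b + 2 * c
    regroup a b c = solve (a ∷ b ∷ c ∷ [])

  D-cong : ∀ {X Y} → (∀ i → X i ≡ Y i) → D X ≡ D Y
  D-cong h = form-cong e h h

  D-mono : ∀ {X Y} → X ⊑ Y → D X ≤ D Y
  D-mono h = form-mono e h h

  D-split : ∀ {X Y} → Y ⊑ X → D X ≡ D Y + D (X ∖ Y) + 2 * B Y (X ∖ Y)
  D-split {X} {Y} h = trans (D-cong (split h)) (D-⊕ Y (X ∖ Y))

  D-⊕δ : ∀ X x → D (X ⊕ δ x) ≡ D X + 2 * row x X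
  D-⊕δ X x = trans (D-⊕ X (δ x)) (cong₂ _+_ (trans (cong (D X +_) (D-δ x)) (+-identityʳ (D X))) (cong (2 *_) (B-δʳ X x)))

  B-∅ˡ : ∀ {X} → (∀ i → X i ≡ 0) → ∀ Y → B X Y ≡ 0
  B-∅ˡ h Y = trans (form-cong e h (λ _ → refl)) (dot-∅ _)

  row-⊕ : ∀ x X Y → row x (X ⊕ Y) ≡ row x X + row x Y
  row-⊕ x = dot-⊕ (e x)

  row-mono : ∀ x {X Y} → X ⊑ Y → row x X ≤ row x Y
  row-mono x = dot-monoʳ (e x)

  edge⇒row : ∀ {x y X} → X y ≡ 1 → e x y ≤ row x X
  edge⇒row {x} h = term≤dot (e x) h

  row≥1 : ∀ {x X} → Bit X → 1 ≤ row x X → ∃ λ y → X y ≡ 1 × e x y ≡ 1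
  row≥1 {x} b h with dot≥1 b h
  ... | y , p , q = y , p , ≤-antisym (e-bit x y) q

  row≡0 : ∀ {x y X} → row x X ≡ 0 → X y ≡ 1 → e x y ≡ 0
  row≡0 {x} h = dot≡0 {f = e x} h

  -- This is ρ(S) ≥ 1 on nonempty sets: `D` counts every edge twice, so `2 * D S` is 4|E(S)|.
  Good : Pt n → (Fin n → Ty) → Set
  Good V t = ∀ S → S ⊑ V → ∀ x → S x ≡ 1 → 1 + 2 * D S ≤ W t S

  -- Acyclicity by counting: a nonempty S spans at most |S| - 1 edges, which the vertex set of a
  -- cycle violates. In this form the gluing of forests is arithmetic.
  Forest : Pt n → Set
  Forest X = ∀ S → S ⊑ X → ∀ x → S x ≡ 1 → D S + 2 ≤ 2 * size S

  -- `indep` and `sparse` together put the members of `I` at distance at least 3 in the graph on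
  -- `V`.
  record Col (V : Pt n) (t : Fin n → Ty) : Set where
    field
      I      : Pt n
      I⊑V    : I ⊑ V
      I-U    : ∀ x → I x ≡ 1 → t x ≡ U
      indep  : ∀ x → I x ≡ 1 → row x I ≡ 0
      sparse : ∀ x → V x ≡ 1 → row x I ≤ 1
      avoid  : ∀ x → V x ≡ 1 → t x ≡ N → row x I ≡ 0
      forest : Forest (V ∖ I)

  Forest-mono : ∀ {X Y} → X ⊑ Y → Forest Y → Forest X
  Forest-mono h f S p = f S (⊑-trans p h)

  markF markN : Pt n → (Fin n → Ty) → Fin n → Ty
  markF X t i = forceF (row i X) (t i)
  markN X t i = forceN (row i X) (t i)

  W-markF : ∀ X t S → W t S ≤ W (markF X t) S + B S X
  W-markF X t S =
    ≤-trans (dot-mono (λ i → w-forceF (row i X) (t i)) (λ _ → ≤-refl)) (≤-reflexive (dot-⊕ˡ (λ i → w (markF X t i)) (λ i → row i X) S))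

  W-markN : ∀ X t S → W t S ≤ W (markN X t) S + 3 * B S X
  W-markN X t S =
    ≤-trans (dot-mono (λ i → w-forceN (row i X) (t i)) (λ _ → ≤-refl))
    (≤-reflexive (trans (dot-⊕ˡ (λ i → w (markN X t i)) (λ i → 3 * row i X) S)
                        (cong (W (markN X t) S +_) (dot-scale 3 (λ i → row i X) S))))

  -- From two vertices on, the second copy of `size S` absorbs the 2; a singleton has no edge, as
  -- adjacency is irreflexive.
  sparse-forest : ∀ {S s} → Bit S → S s ≡ 1 → D S ≤ size S → D S + 2 ≤ 2 * size S
  sparse-forest {S} {s} b h d with Empty? (⊑-trans (∖-⊑ S (δ s)) b)
  ... | inj₂ (y , q) = arith (D S) (size S) d
        (≤-trans (+-mono-≤ (≤-reflexive (sym (size-δ s))) (size≥1 {X = S ∖ δ s} q)) (≤-reflexive (sym (dot-split full (δ-⊑ h)))))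
    where
    arith : ∀ d s → d ≤ s → 2 ≤ s → d + 2 ≤ 2 * s
    arith d s h k = lin 0 (h ⊞ k) (solve (d ∷ s ∷ []))
  ... | inj₁ q = ≤-trans (≤-reflexive (cong (_+ 2) (trans (D-cong S≗δ) (D-δ s)))) (*-monoʳ-≤ 2 (size≥1 {X = S} h))
    where
    S≗δ : ∀ i → S i ≡ δ s i
    S≗δ i = trans (split (δ-⊑ {X = S} h) i) (trans (cong (δ s i +_) (q i)) (+-identityʳ _))

  -- `S` is cut into its parts in `X` and `Y`. If one part is empty, the other side's forest bound
  -- decides; only a set meeting both sides needs the last hypothesis, for which the two bounds
  -- leave room for one crossing edge.
  forest-⊕ : ∀ {X Y} → Bit (X ⊕ Y) → Forest X → Forest Y →
             (∀ P Q → P ⊑ X → Q ⊑ Y → ∀ p q → P p ≡ 1 → Q q ≡ 1 → D P + D Q + 2 * B P Q + 2 ≤ 2 * (size P + size Q)) →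
             Forest (X ⊕ Y)
  forest-⊕ {X} {Y} b f g h S S⊑ s s∈ =
    ≤-trans (≤-reflexive (cong (_+ 2) (D-split P⊑S))) (≤-trans bound (≤-reflexive (cong (2 *_) (sym (dot-split full P⊑S)))))
    where
    P Q : Pt n
    P = S ⊓ X
    Q = S ∖ P
    bS = ⊑-trans S⊑ b
    bX : Bit X
    bX i = ≤-trans (m≤m+n (X i) (Y i)) (b i)
    P⊑S : P ⊑ S
    P⊑S = ⊓-⊑ˡ bX
    Q⊑Y : Q ⊑ Y
    Q⊑Y i with bit (bX i) | S⊑ i
    ... | inj₁ q | p rewrite q | *-zeroʳ (S i) = p
    ... | inj₂ q | p rewrite q | *-identityʳ (S i) | n∸n≡0 (S i) = z≤n
    arithQ : ∀ {dp b} dq p q → dp ≡ 0 → b ≡ 0 → dq + 2 ≤ 2 * q → dp + dq + 2 * b + 2 ≤ 2 * (p + q)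
    arithQ dq p q refl refl h = lin (2 * p) h (solve (dq ∷ p ∷ q ∷ []))
    arithP : ∀ {dq b} dp p q → dq ≡ 0 → b ≡ 0 → dp + 2 ≤ 2 * p → dp + dq + 2 * b + 2 ≤ 2 * (p + q)
    arithP dp p q refl refl h = lin (2 * q) h (solve (dp ∷ p ∷ q ∷ []))
    bound : D P + D Q + 2 * B P Q + 2 ≤ 2 * (size P + size Q)
    bound with Empty? (⊑-trans P⊑S bS) | Empty? (⊑-trans (∖-⊑ S P) bS)
    ... | inj₂ (p , p∈) | inj₂ (q , q∈) = h P Q (⊓-⊑ʳ bS) Q⊑Y p q p∈ q∈
    ... | inj₂ (p , p∈) | inj₁ q = arithP (D P) (size P) (size Q) (B-∅ˡ q Q) (trans (B-comm P Q) (B-∅ˡ q P)) (f P (⊓-⊑ʳ bS) p p∈)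
    ... | inj₁ p | inj₂ (q , q∈) = arithQ (D Q) (size P) (size Q) (B-∅ˡ p P) (B-∅ˡ p Q) (g Q Q⊑Y q q∈)
    ... | inj₁ p | inj₁ q = 1≢0 s∈ (trans (split P⊑S s) (cong₂ _+_ (p s) (q s)))

  -- Adding `Q` to `P` adds B P Q + D Q / 2 edges, and summing the degrees of `Q` bounds this by
  -- `size Q`. Edges between two vertices of `Y` are allowed.
  forest-⊕-leaves : ∀ {X Y} → Bit (X ⊕ Y) → Forest X → (∀ y → Y y ≡ 1 → row y (X ⊕ Y) ≤ 1) → Forest (X ⊕ Y)
  forest-⊕-leaves {X} {Y} b f leaf = forest-⊕ b f g h
    where
    bY : Bit Y
    bY i = ≤-trans (m≤n+m (Y i) (X i)) (b i)
    few : ∀ {P Q} → P ⊑ X → Q ⊑ Y → B P Q + D Q ≤ size Q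
    few {P} {Q} p q = begin
      B P Q + D Q   ≡⟨ cong (_+ D Q) (B-comm P Q) ⟩
      B Q P + D Q   ≡⟨ form-⊕ʳ e Q P Q ⟨
      B Q (P ⊕ Q)   ≤⟨ dot-const 1 (⊑-trans q bY) (λ i h → ≤-trans (row-mono i λ j → +-mono-≤ (p j) (q j)) (leaf i (⊑1 q bY h))) ⟩
      1 * size Q    ≡⟨ *-identityˡ (size Q) ⟩
      size Q        ∎
      where open ≤-Reasoning
    g : Forest Y
    g S S⊑ s s∈ = sparse-forest (⊑-trans S⊑ bY) s∈ (≤-trans (m≤n+m (D S) (B ∅ S)) (few (λ _ → z≤n) S⊑))
    arith : ∀ dp dq b p q → b + dq ≤ q → dp + 2 ≤ 2 * p → dp + dq + 2 * b + 2 ≤ 2 * (p + q)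
    arith dp dq b p q h k = lin dq (2 ⊠ h ⊞ k) (solve (dp ∷ dq ∷ b ∷ p ∷ q ∷ []))
    h : ∀ P Q → P ⊑ X → Q ⊑ Y → ∀ p q → P p ≡ 1 → Q q ≡ 1 → D P + D Q + 2 * B P Q + 2 ≤ 2 * (size P + size Q)
    h P Q P⊑ Q⊑ p q p∈ q∈ = arith (D P) (D Q) (B P Q) (size P) (size Q) (few P⊑ Q⊑) (f P P⊑ p p∈)

  row-zero : ∀ {x X Y} → Bit Y → (∀ y → Y y ≡ 1 → row y X ≡ 0) → X x ≡ 1 → row x Y ≡ 0
  row-zero {x} b h x∈ = dot-zeroˡ b λ y y∈ → trans (e-sym x y) (row≡0 (h y y∈) x∈)

  Col-cong : ∀ {X Y t} → (∀ i → X i ≡ Y i) → Col X t → Col Y t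
  Col-cong {X} {Y} h c = record
    { I = I
    ; I⊑V = λ i → ≤-trans (I⊑V i) (≤-reflexive (h i))
    ; I-U = I-U
    ; indep = indep
    ; sparse = λ x p → sparse x (trans (h x) p)
    ; avoid = λ x p → avoid x (trans (h x) p)
    ; forest = Forest-mono (λ i → ≤-reflexive (cong (_∸ I i) (sym (h i)))) forest }
    where open Col c

  good-markF : ∀ {A X t} → (∀ S → S ⊑ A → ∀ x → S x ≡ 1 → 1 + 2 * D S + B S X ≤ W t S) → Good A (markF X t)
  good-markF {A} {X} {t} h S S⊑ x x∈ = +-cancelʳ-≤ (B S X) _ _ (≤-trans (h S S⊑ x x∈) (W-markF X t S))

  Potential≥2 : Pt n → (Fin n → Ty) → Set
  Potential≥2 V t = ∀ S → S ⊑ V → ∀ x → S x ≡ 1 → ∀ y → V y ≡ 1 → S y ≡ 0 → 2 + 2 * D S ≤ W t S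

-- Reducible configurations

-- The ends of the at most one edge between A and R are both put into F.
module Cut {n} (G : Adj n) {A R : Pt n} (bV : Bit (A ⊕ R)) (t : Fin n → Ty) where
  open Net G

  private
    bA : Bit A
    bA i = ≤-trans (m≤m+n (A i) (R i)) (bV i)
    bR : Bit R
    bR i = ≤-trans (m≤n+m (R i) (A i)) (bV i)

  -- The marks leave members of `I` without neighbours on the other side, so the conditions on `I`
  -- hold side by side, and a single edge between two forests closes no cycle.
  cut-glue : B A R ≤ 1 → Col A (markF R t) → Col R (markF A t) → Col (A ⊕ R) t
  cut-glue AR≤1 c d = record
    { I = I
    ; I⊑V = λ i → +-mono-≤ (C.I⊑V i) (E.I⊑V i)
    ; I-U = λ x h → [ (λ p → proj₂ (U₁ x p)) , (λ p → proj₂ (U₂ x p)) ]′ (∈-⊕ h)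
    ; indep = λ x h → [ (λ p → both x (C.indep x p) (cross₁ (⊑1 C.I⊑V bA p)))
                      , (λ p → both x (cross₂ (⊑1 E.I⊑V bR p)) (E.indep x p)) ]′ (∈-⊕ h)
    ; sparse = λ x h → [ (λ p → ≤-trans (≤-reflexive (only₁ x (cross₁ p))) (C.sparse x p))
                       , (λ p → ≤-trans (≤-reflexive (only₂ x (cross₂ p))) (E.sparse x p)) ]′ (∈-⊕ h)
    ; avoid = λ x h q → [ (λ p → both x (C.avoid x p (forceF-N (row x R) q)) (cross₁ p))
                        , (λ p → both x (cross₂ p) (E.avoid x p (forceF-N (row x A) q))) ]′ (∈-⊕ h)
    ; forest = Forest-mono (⊕-∖ C.I⊑V E.I⊑V)
        (forest-⊕ (λ i → ≤-trans (+-mono-≤ (∖-⊑ A C.I i) (∖-⊑ R E.I i)) (bV i)) C.forest E.forest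
          λ P Q p q x y hx hy → arith (D P) (D Q) (B P Q) (size P) (size Q)
            (≤-trans (form-mono e (⊑-trans p (∖-⊑ A C.I)) (⊑-trans q (∖-⊑ R E.I))) AR≤1)
            (C.forest P p x hx) (E.forest Q q y hy)) }
    where
    module C = Col c
    module E = Col d
    I = C.I ⊕ E.I
    U₁ : ∀ x → C.I x ≡ 1 → row x R ≡ 0 × t x ≡ U
    U₁ x p = forceF-U (row x R) (C.I-U x p)
    U₂ : ∀ x → E.I x ≡ 1 → row x A ≡ 0 × t x ≡ U
    U₂ x p = forceF-U (row x A) (E.I-U x p)
    cross₁ : ∀ {x} → A x ≡ 1 → row x E.I ≡ 0
    cross₁ = row-zero (⊑-trans E.I⊑V bR) λ y p → proj₁ (U₂ y p)
    cross₂ : ∀ {x} → R x ≡ 1 → row x C.I ≡ 0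
    cross₂ = row-zero (⊑-trans C.I⊑V bA) λ y p → proj₁ (U₁ y p)
    both : ∀ x → row x C.I ≡ 0 → row x E.I ≡ 0 → row x I ≡ 0
    both x p q = trans (row-⊕ x C.I E.I) (cong₂ _+_ p q)
    only₁ : ∀ x → row x E.I ≡ 0 → row x I ≡ row x C.I
    only₁ x p = trans (row-⊕ x C.I E.I) (trans (cong (row x C.I +_) p) (+-identityʳ _))
    only₂ : ∀ x → row x C.I ≡ 0 → row x I ≡ row x E.I
    only₂ x p = trans (row-⊕ x C.I E.I) (cong (_+ row x E.I) p)
    arith : ∀ dp dq b p q → b ≤ 1 → dp + 2 ≤ 2 * p → dq + 2 ≤ 2 * q → dp + dq + 2 * b + 2 ≤ 2 * (p + q)
    arith dp dq b p q h₀ h₁ h₂ = lin 0 (2 ⊠ h₀ ⊞ h₁ ⊞ h₂) (solve (dp ∷ dq ∷ b ∷ p ∷ q ∷ []))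

-- v is put into I and its neighbours, all of degree 2, into F.
module Star {n} (G : Adj n) {V : Pt n} (bV : Bit V) (t : Fin n → Ty) where
  open Net G

  module _ {v} (v∈ : V v ≡ 1) (tv : t v ≡ U)
           (nbr : ∀ j → V j ≡ 1 → e v j ≡ 1 → t j ≡ U × row j V ≡ 2) where

    J A : Pt n
    J = e v ⊓ V
    A = V ∖ (δ v ⊕ J)

    private
      J-bit : Bit J
      J-bit = ⊑-trans (⊓-⊑ʳ (e-bit v)) bV

      J⇒ : ∀ {j} → J j ≡ 1 → V j ≡ 1 × e v j ≡ 1
      J⇒ {j} h = ⊑1 (⊓-⊑ʳ (e-bit v)) bV h , ⊑1 (⊓-⊑ˡ bV) (e-bit v) h

      ball⊑V : δ v ⊕ J ⊑ V
      ball⊑V i with v ≟ i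
      ... | yes refl = ≤-reflexive (trans (cong₂ _+_ (δ-self v) (cong (_* V v) (e-irr v))) (sym v∈))
      ... | no ne = ≤-trans (≤-reflexive (cong (_+ J i) (δ-other ne))) (⊓-⊑ʳ {Y = V} (e-bit v) i)

      A⊑V : A ⊑ V
      A⊑V = ∖-⊑ V (δ v ⊕ J)

      bA : Bit A
      bA = ⊑-trans A⊑V bV

      A⇒ : ∀ {x} → A x ≡ 1 → e v x ≡ 0
      A⇒ {x} h with ∈-∖ {Y = δ v ⊕ J} bV h
      ... | p , q with bit (e-bit v x)
      ... | inj₁ z = z
      ... | inj₂ z = 1≢0 (cong₂ _*_ z p) (m+n≡0⇒n≡0 (δ v x) q)

      v∉A : A v ≡ 0
      v∉A = trans (cong₂ _∸_ v∈ (cong₂ _+_ (δ-self v) (cong (_* V v) (e-irr v)))) refl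

      rowJ≤1 : ∀ {j S} → S ⊑ V → S v ≡ 0 → J j ≡ 1 → row j S ≤ 1
      rowJ≤1 {j} {S} S⊑ v∉ h with J⇒ h
      ... | j∈ , evj = arith (row j S) (≤-trans (≤-reflexive (sym (row-⊕ j S (δ v)))) (≤-trans (row-mono j S+v⊑V) (≤-reflexive (proj₂ (nbr j j∈ evj)))))
                             (trans (row-δ j v) (trans (e-sym j v) evj))
        where
        S+v⊑V : S ⊕ δ v ⊑ V
        S+v⊑V i with v ≟ i
        ... | yes refl = ≤-reflexive (trans (cong₂ _+_ v∉ (δ-self v)) (sym v∈))
        ... | no ne = ≤-trans (≤-reflexive (trans (cong (S i +_) (δ-other ne)) (+-identityʳ (S i)))) (S⊑ i)
        arith : ∀ {d} r → r + d ≤ 2 → d ≡ 1 → r ≤ 1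
        arith r h refl = lin 0 h (solve (r ∷ []))

    -- Let k vertices of `J` have a neighbour in `S`, so that marking costs k. Adding them and `v`
    -- to `S` brings weight 5k + 5 and at least 2k edges, whence ρ(S) ≥ ρ(X) + 3k - 5, and ρ(S) ≥ k
    -- + 1 is wanted. For k ≥ 3, ρ(X) ≥ 1 is enough; for k = 2, `X` misses a neighbour of `v`, so
    -- ρ(X) ≥ 2; for k ≤ 1 the bounds on `S` itself do.
    star-good : Good V t → Potential≥2 V t → 3 ≤ row v V → Good A (markF J t)
    star-good good potential≥2 deg = good-markF λ S S⊑ s s∈ → bound S S⊑ s s∈
      where
      module _ (S : Pt n) (S⊑ : S ⊑ A) (s : Fin n) (s∈ : S s ≡ 1) where
        -- A vertex of `J` has degree 2 and is adjacent to `v`, so it has at most one neighbour in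
        -- `S`. Hence `K` is a set, and its size is the number of edges from `S` to `J`.
        K X : Pt n
        K i = row i S * J i
        X = (S ⊕ K) ⊕ δ v
        S⊑V : S ⊑ V
        S⊑V = ⊑-trans S⊑ A⊑V
        v∉S : S v ≡ 0
        v∉S = ⊑0 S⊑ v∉A
        K⊑J : K ⊑ J
        K⊑J i with bit (J-bit i)
        ... | inj₁ q = ≤-reflexive (trans (cong (row i S *_) q) (trans (*-zeroʳ (row i S)) (sym q)))
        ... | inj₂ q = ≤-trans (*-monoˡ-≤ (J i) (rowJ≤1 S⊑V v∉S q)) (≤-reflexive (*-identityˡ (J i)))
        bK : Bit K
        bK = ⊑-trans K⊑J J-bit
        X⊑V : X ⊑ V
        X⊑V i = ≤-trans (+-monoˡ-≤ (δ v i) (+-mono-≤ (S⊑ i) (K⊑J i)))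
          (≤-reflexive (trans (regroup (A i) (J i) (δ v i)) (sym (split ball⊑V i))))
          where
          regroup : ∀ a j d → a + j + d ≡ d + j + a
          regroup a j d = solve (a ∷ j ∷ d ∷ [])
        BSJ : B S J ≡ size K
        BSJ = trans (B-comm S J) (dot-size (λ i → row i S) J)
        K⇒ : ∀ {k} → K k ≡ 1 → row k S ≡ 1 × J k ≡ 1
        K⇒ {k} h = m*n≡1⇒m≡1 (row k S) (J k) h , m*n≡1⇒n≡1 (row k S) (J k) h
        BSK : size K ≤ B S K
        BSK = ≤-trans (dot-≤ {f = full} {g = λ i → row i S} bK λ i h → ≤-reflexive (sym (proj₁ (K⇒ h)))) (≤-reflexive (B-comm K S))
        rvK : size K ≤ row v K
        rvK = dot-≤ {f = full} {g = e v} bK λ i h → ≤-reflexive (sym (proj₂ (J⇒ (proj₂ (K⇒ h)))))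
        DX : D S + 4 * size K ≤ D X
        DX = arith (D S) (D K) (B S K) (row v S) (row v K) (size K)
               (trans (D-⊕δ (S ⊕ K) v) (cong₂ (λ a b → a + 2 * b) (D-⊕ S K) (row-⊕ v S K))) BSK rvK
          where
          arith : ∀ {d} s k b r q z → d ≡ s + k + 2 * b + 2 * (r + q) → z ≤ b → z ≤ q → s + 4 * z ≤ d
          arith s k b r q z refl h₁ h₂ = lin (k + 2 * r) (2 ⊠ h₁ ⊞ 2 ⊠ h₂) (solve (s ∷ k ∷ b ∷ r ∷ q ∷ z ∷ []))
        WX : W t X ≡ W t S + 5 * size K + 5
        WX = trans (dot-⊕ _ (S ⊕ K) (δ v)) (cong₂ _+_ (trans (dot-⊕ _ S K) (cong (W t S +_) WK)) (trans (dot-δ _ v) (cong w tv)))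
          where
          WK : W t K ≡ 5 * size K
          WK = trans (dot-≡ {g = λ i → 5 * full i} bK λ i h → cong w (proj₁ (nbr i (proj₁ (J⇒ (proj₂ (K⇒ h)))) (proj₂ (J⇒ (proj₂ (K⇒ h)))))))
                     (dot-scale 5 full K)
        v∈X : X v ≡ 1
        v∈X = trans (cong₂ _+_ (cong₂ _+_ v∉S (trans (cong (λ z → row v S * (z * V v)) (e-irr v)) (*-zeroʳ (row v S)))) (δ-self v)) refl
        transfer : ∀ c → c + 2 * D X ≤ W t X → c + 2 * D S + 3 * size K ≤ W t S + 5
        transfer c h = arith (D X) (D S) (size K) (W t S) c (≤-trans h (≤-reflexive WX)) DX
          where
          arith : ∀ dx ds k ws c → c + 2 * dx ≤ ws + 5 * k + 5 → ds + 4 * k ≤ dx → c + 2 * ds + 3 * k ≤ ws + 5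
          arith dx ds k ws c h₁ h₂ = lin 0 (h₁ ⊞ 2 ⊠ h₂) (solve (dx ∷ ds ∷ k ∷ ws ∷ c ∷ []))
        notall : size K ≤ 2 → ∃ λ j → V j ≡ 1 × X j ≡ 0
        notall h with size≥1⇒ (⊑-trans (∖-⊑ J K) J-bit) (arith (size (J ∖ K)) (≤-trans deg′ (≤-reflexive (dot-split full K⊑J))) h)
          where
          deg′ : 3 ≤ size J
          deg′ = ≤-trans deg (≤-reflexive (dot-size (e v) V))
          arith : ∀ {k} r → 3 ≤ k + r → k ≤ 2 → 1 ≤ r
          arith {k} r h₁ h₂ = lin 0 (h₁ ⊞ h₂) (solve (k ∷ r ∷ []))
        ... | j , h with ∈-∖ {Y = K} J-bit h
        ... | j∈J , j∉K = j , proj₁ (J⇒ j∈J) , cong₂ _+_ (cong₂ _+_ (⊑0 S⊑ (j∉A j∈J)) j∉K) (δ-other λ { refl → 1≢0 (proj₂ (J⇒ j∈J)) (e-irr v) })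
          where
          j∉A : ∀ {j} → J j ≡ 1 → A j ≡ 0
          j∉A {j} p with bit (bA j)
          ... | inj₁ z = z
          ... | inj₂ z = 1≢0 (proj₂ (J⇒ p)) (A⇒ z)
        full-star : size K ≡ 2 → (∃ λ j → V j ≡ 1 × X j ≡ 0) → 1 + 2 * D S + size K ≤ W t S
        full-star q (j , j∈ , j∉) = arith (size K) (D S) (W t S) (transfer 2 (potential≥2 X X⊑V v v∈X j j∈ j∉)) q
          where
          arith : ∀ k d x → 2 + 2 * d + 3 * k ≤ x + 5 → k ≡ 2 → 1 + 2 * d + k ≤ x
          arith _ d x h refl = lin 0 h (solve (d ∷ x ∷ []))
        big-star : 3 ≤ size K → 1 + 2 * D S + size K ≤ W t S
        big-star = arith (size K) (D S) (W t S) (transfer 1 (good X X⊑V v v∈X))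
          where
          arith : ∀ k d x → 1 + 2 * d + 3 * k ≤ x + 5 → 3 ≤ k → 1 + 2 * d + k ≤ x
          arith k d x h₁ h₂ = lin 1 (h₁ ⊞ 2 ⊠ h₂) (solve (k ∷ d ∷ x ∷ []))
        none : size K ≡ 0 → 1 + 2 * D S + size K ≤ W t S
        none q = ≤-trans (≤-reflexive (trans (cong (1 + 2 * D S +_) q) (+-identityʳ (1 + 2 * D S)))) (good S S⊑V s s∈)
        one : size K ≡ 1 → 1 + 2 * D S + size K ≤ W t S
        one q = ≤-trans (≤-reflexive (trans (cong (1 + 2 * D S +_) q) (+-comm (1 + 2 * D S) 1))) (potential≥2 S S⊑V s s∈ v v∈ v∉S)
        cases : ∀ k → size K ≡ k → 1 + 2 * D S + size K ≤ W t S
        cases 0 q = none q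
        cases 1 q = one q
        cases 2 q = full-star q (notall (≤-reflexive q))
        cases (suc (suc (suc k))) q = big-star (≤-trans (m≤m+n 3 k) (≤-reflexive (sym q)))
        bound : 1 + 2 * D S + B S J ≤ W t S
        bound = subst (λ z → 1 + 2 * D S + z ≤ W t S) (sym BSJ) (cases (size K) refl)

    -- Neighbours of `J` in `A` are marked F, so a vertex of `J` sees no member of `I` but `v`.
    -- Without `v` every vertex of `J` has at most one neighbour, so `J` extends the forest by
    -- leaves.
    star-glue : Col A (markF J t) → Col V t
    star-glue c = record
      { I = I ⊕ δ v
      ; I⊑V = λ i → ≤-trans (+-mono-≤ (I⊑V i) (m≤m+n (δ v i) (J i))) (≤-reflexive (trans (+-comm (A i) _) (sym (split ball⊑V i))))
      ; I-U = λ x h → [ (λ p → proj₂ (free x p)) , (λ p → subst (λ z → t z ≡ U) (δ1 p) tv) ]′ (∈-⊕ h)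
      ; indep = λ x h → [ (λ p → trans (atA x (⊑1 I⊑V bA p)) (indep x p))
                        , (λ p → subst (λ z → row z (I ⊕ δ v) ≡ 0) (δ1 p) atv) ]′ (∈-⊕ h)
      ; sparse = λ x h → place x h (λ y → row y (I ⊕ δ v) ≤ 1)
                   (λ p → ≤-trans (≤-reflexive (atA x p)) (sparse x p)) (≤-trans (≤-reflexive atv) z≤n) (λ p → ≤-trans (≤-reflexive (atJ x p)) (e-bit x v))
      ; avoid = λ x h → place x h (λ y → t y ≡ N → row y (I ⊕ δ v) ≡ 0)
                   (λ p q → trans (atA x p) (avoid x p (forceF-N (row x J) q))) (λ _ → atv)
                   (λ p q → ⊥-elim (U≢N (trans (sym (proj₁ (nbr x h (proj₂ (J⇒ p))))) q)))
      ; forest = Forest-mono V⊑ (forest-⊕-leaves (⊑-trans F⊑V bV) forest λ j p → rowJ≤1 F⊑V v∉F p) }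
      where
      open Col c
      U≢N : U ≢ N
      U≢N ()
      bI : Bit I
      bI = ⊑-trans I⊑V bA
      free : ∀ x → I x ≡ 1 → row x J ≡ 0 × t x ≡ U
      free x p = forceF-U (row x J) (I-U x p)
      place : ∀ x → V x ≡ 1 → (Q : Fin n → Set) → (A x ≡ 1 → Q x) → Q v → (J x ≡ 1 → Q x) → Q x
      place x h Q a b c with ∈-split ball⊑V h
      ... | inj₂ p = a p
      ... | inj₁ p with ∈-⊕ {δ v x} p
      ... | inj₁ q = subst Q (δ1 q) b
      ... | inj₂ q = c q
      atA : ∀ x → A x ≡ 1 → row x (I ⊕ δ v) ≡ row x I
      atA x p = trans (row-⊕ x I (δ v)) (trans (cong (row x I +_) (trans (row-δ x v) (trans (e-sym x v) (A⇒ p)))) (+-identityʳ _))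
      atv : row v (I ⊕ δ v) ≡ 0
      atv = trans (row-⊕ v I (δ v)) (cong₂ _+_ (dot-zeroˡ bI λ y p → A⇒ (⊑1 I⊑V bA p)) (trans (row-δ v v) (e-irr v)))
      atJ : ∀ x → J x ≡ 1 → row x (I ⊕ δ v) ≡ e x v
      atJ x p = trans (row-⊕ x I (δ v)) (cong₂ _+_ (row-zero bI (λ y q → proj₁ (free y q)) p) (row-δ x v))
      F⊑V : (A ∖ I) ⊕ J ⊑ V
      F⊑V i = ≤-trans (+-mono-≤ (∖-⊑ A I i) (m≤n+m (J i) (δ v i))) (≤-reflexive (trans (+-comm (A i) _) (sym (split ball⊑V i))))
      v∉F : ((A ∖ I) ⊕ J) v ≡ 0
      v∉F = cong₂ _+_ (⊑0 {X = A ∖ I} (∖-⊑ A I) v∉A) (cong (_* V v) (e-irr v))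
      V⊑ : V ∖ (I ⊕ δ v) ⊑ (A ∖ I) ⊕ J
      V⊑ i = begin
        V i ∸ (I i + δ v i)                    ≡⟨ cong (_∸ (I i + δ v i)) (trans (split ball⊑V i) (+-comm _ (A i))) ⟩
        A i + (δ v i + J i) ∸ (I i + δ v i)    ≤⟨ ⊕-∖ {R = δ v ⊕ J} I⊑V (λ j → m≤m+n (δ v j) (J j)) i ⟩
        (A i ∸ I i) + (δ v i + J i ∸ δ v i)    ≡⟨ cong ((A i ∸ I i) +_) (m+n∸m≡n (δ v i) (J i)) ⟩
        (A i ∸ I i) + J i                      ∎
        where open ≤-Reasoning

-- The path v a b x: if v or x is in I then a and b are put into F, otherwise a
-- is put into I and b into F.
module Thread {n} (G : Adj n) {V : Pt n} (bV : Bit V) (t : Fin n → Ty) where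
  open Net G

  -- `ha` and `hb` name the neighbours through counts, a form in which `x` may coincide with `v`.
  module _ {a b v x} (a∈ : V a ≡ 1) (b∈ : V b ≡ 1) (ta : t a ≡ U) (tb : t b ≢ N) (tv : t v ≢ N)
           (ha : ∀ S → S ⊑ V → row a S ≡ S v + S b) (hb : ∀ S → S ⊑ V → row b S ≡ S a + S x) where

    A : Pt n
    A = V ∖ (δ a ⊕ δ b)

    private
      eaδ : ∀ y → V y ≡ 1 → e a y ≡ δ y v + δ y b
      eaδ y y∈ = trans (sym (row-δ a y)) (ha (δ y) (δ-⊑ y∈))

      a≢b : a ≢ b
      a≢b refl = 1≢0 (δ-self a) (m+n≡0⇒n≡0 (δ a v) (trans (sym (eaδ a a∈)) (e-irr a)))

      pair⊑V : δ a ⊕ δ b ⊑ V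
      pair⊑V i with a ≟ i
      ... | yes refl = ≤-reflexive (trans (cong₂ _+_ (δ-self a) (δ-other λ p → a≢b (sym p))) (sym a∈))
      ... | no ne = ≤-trans (≤-reflexive (cong (_+ δ b i) (δ-other ne))) (δ-⊑ b∈ i)

      A⊑V : A ⊑ V
      A⊑V = ∖-⊑ V (δ a ⊕ δ b)

      bA : Bit A
      bA = ⊑-trans A⊑V bV

      a∉A : A a ≡ 0
      a∉A = cong₂ _∸_ a∈ (cong₂ _+_ (δ-self a) (δ-other λ p → a≢b (sym p)))

      b∉A : A b ≡ 0
      b∉A = cong₂ _∸_ b∈ (cong₂ _+_ (δ-other a≢b) (δ-self b))

      A≢a : ∀ {y} → A y ≡ 1 → a ≢ y
      A≢a h refl = 1≢0 h a∉A

      A≢b : ∀ {y} → A y ≡ 1 → b ≢ y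
      A≢b h refl = 1≢0 h b∉A

      place : ∀ y → V y ≡ 1 → (Q : Fin n → Set) → (A y ≡ 1 → Q y) → Q a → Q b → Q y
      place y h Q p q r with ∈-split pair⊑V h
      ... | inj₂ k = p k
      ... | inj₁ k with ∈-⊕ {δ a y} k
      ... | inj₁ l = subst Q (δ1 l) q
      ... | inj₂ l = subst Q (δ1 l) r

    -- `markF (δ v)` marks the neighbours of `v`, not `v` itself, at a price of one unit per edge
    -- from `S` to `v`.
    thread-good : (∀ S → S ⊑ A → ∀ s → S s ≡ 1 → 1 + 2 * D S + row v S ≤ W t S) → Good A (markF (δ v) t)
    thread-good h = good-markF λ S S⊑ s s∈ → ≤-trans (≤-reflexive (cong (1 + 2 * D S +_) (B-δʳ S v))) (h S S⊑ s s∈)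

    -- If `v` is in `I`, then `b` hangs on `x` and `a` on `b` in the forest; if `x` is in `I`, `a`
    -- hangs on `v` and `b` on `a`. If neither is, `a` may join `I`: the marks keep all other
    -- neighbours of `v` out of `I`, and `b` hangs on `x`.
    thread-glue : Col A (markF (δ v) t) → Col V t
    thread-glue c = conclude (bit (bI v)) (bit (bI x))
      where
      open Col c
      bI : Bit I
      bI = ⊑-trans I⊑V bA
      I⊑ : I ⊑ V
      I⊑ = ⊑-trans I⊑V A⊑V
      a∉I : I a ≡ 0
      a∉I = ⊑0 I⊑V a∉A
      b∉I : I b ≡ 0
      b∉I = ⊑0 I⊑V b∉A
      free : ∀ y → I y ≡ 1 → row y (δ v) ≡ 0 × t y ≡ U
      free y p = forceF-U (row y (δ v)) (I-U y p)
      rowa : row a I ≡ I v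
      rowa = trans (ha I I⊑) (trans (cong (I v +_) b∉I) (+-identityʳ (I v)))
      rowb : row b I ≡ I x
      rowb = trans (hb I I⊑) (cong (_+ I x) a∉I)
      Fo : Pt n
      Fo = A ∖ I
      Fo⊑A : Fo ⊑ A
      Fo⊑A = ∖-⊑ A I

      A⊕pair : ∀ i → A i + (δ a i + δ b i) ≡ V i
      A⊕pair i = trans (+-comm (A i) _) (sym (split pair⊑V i))

      Fo⊕a⊑ : Fo ⊕ δ a ⊑ V
      Fo⊕a⊑ i = ≤-trans (+-mono-≤ (Fo⊑A i) (m≤m+n (δ a i) (δ b i))) (≤-reflexive (A⊕pair i))
      Fo⊕b⊑ : Fo ⊕ δ b ⊑ V
      Fo⊕b⊑ i = ≤-trans (+-mono-≤ (Fo⊑A i) (m≤n+m (δ b i) (δ a i))) (≤-reflexive (A⊕pair i))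
      Fo⊕a⊕b⊑ : Fo ⊕ δ a ⊕ δ b ⊑ V
      Fo⊕a⊕b⊑ i = ≤-trans (+-monoˡ-≤ (δ b i) (+-monoˡ-≤ (δ a i) (Fo⊑A i))) (≤-reflexive (trans (+-assoc (A i) _ _) (A⊕pair i)))
      Fo⊕b⊕a⊑ : Fo ⊕ δ b ⊕ δ a ⊑ V
      Fo⊕b⊕a⊑ i = ≤-trans (≤-reflexive (swap (Fo i) (δ a i) (δ b i))) (Fo⊕a⊕b⊑ i)
        where
        swap : ∀ f a b → f + b + a ≡ f + a + b
        swap f a b = solve (f ∷ a ∷ b ∷ [])

      leaf : ∀ {X y} → X ⊕ δ y ⊑ V → Forest X → row y (X ⊕ δ y) ≤ 1 → Forest (X ⊕ δ y)
      leaf h f r = forest-⊕-leaves (⊑-trans h bV) f λ z p → subst (λ z → row z _ ≤ 1) (δ1 p) r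

      Foa : Forest (Fo ⊕ δ a)
      Foa = leaf Fo⊕a⊑ forest (≤-trans (≤-reflexive (trans (ha _ Fo⊕a⊑) (cong ((Fo ⊕ δ a) v +_) b∉))) (≤-trans (≤-reflexive (+-identityʳ _)) (⊑-trans Fo⊕a⊑ bV v)))
        where
        b∉ : (Fo ⊕ δ a) b ≡ 0
        b∉ = cong₂ _+_ (⊑0 {X = Fo} Fo⊑A b∉A) (δ-other a≢b)
      Fob : Forest (Fo ⊕ δ b)
      Fob = leaf Fo⊕b⊑ forest (≤-trans (≤-reflexive (trans (hb _ Fo⊕b⊑) (cong (_+ (Fo ⊕ δ b) x) a∉))) (⊑-trans Fo⊕b⊑ bV x))
        where
        a∉ : (Fo ⊕ δ b) a ≡ 0
        a∉ = cong₂ _+_ (⊑0 {X = Fo} Fo⊑A a∉A) (δ-other λ p → a≢b (sym p))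

      V∖I⊑ : ∀ i → V i ∸ I i ≤ Fo i + (δ a i + δ b i)
      V∖I⊑ i = ≤-trans (≤-reflexive (cong₂ _∸_ (sym (A⊕pair i)) (sym (+-identityʳ (I i))))) (⊕-∖ {R = δ a ⊕ δ b} {J = ∅} I⊑V (λ _ → z≤n) i)

      keep : Forest (V ∖ I) → Col V t
      keep f = record
        { I = I ; I⊑V = I⊑ ; I-U = λ y p → proj₂ (free y p) ; indep = indep
        ; sparse = λ y h → place y h (λ y → row y I ≤ 1) (sparse y) (≤-trans (≤-reflexive rowa) (bI v)) (≤-trans (≤-reflexive rowb) (bI x))
        ; avoid = λ y h → place y h (λ y → t y ≡ N → row y I ≡ 0)
                    (λ p q → avoid y p (forceF-N (row y (δ v)) q)) (λ q → ⊥-elim (U≢N (trans (sym ta) q))) (λ q → ⊥-elim (tb q))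
        ; forest = f }
        where
        U≢N : U ≢ N
        U≢N ()

      conclude : I v ≡ 0 ⊎ I v ≡ 1 → I x ≡ 0 ⊎ I x ≡ 1 → Col V t
      conclude (inj₂ v∈I) _ = keep (Forest-mono (λ i → ≤-trans (V∖I⊑ i) (≤-reflexive (swap (Fo i) (δ a i) (δ b i))))
          (leaf Fo⊕b⊕a⊑ Fob (≤-trans (≤-reflexive (trans (ha _ Fo⊕b⊕a⊑) (cong (_+ (Fo ⊕ δ b ⊕ δ a) b) v∉))) (⊑-trans Fo⊕b⊕a⊑ bV b))))
        where
        v∈A = ⊑1 I⊑V bA v∈I
        v∉ : (Fo ⊕ δ b ⊕ δ a) v ≡ 0
        v∉ = cong₂ _+_ (cong₂ _+_ (cong₂ _∸_ v∈A v∈I) (δ-other (A≢b v∈A))) (δ-other (A≢a v∈A))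
        swap : ∀ f a b → f + (a + b) ≡ f + b + a
        swap f a b = solve (f ∷ a ∷ b ∷ [])
      conclude _ (inj₂ x∈I) = keep (Forest-mono (λ i → ≤-trans (V∖I⊑ i) (≤-reflexive (sym (+-assoc (Fo i) (δ a i) (δ b i)))))
          (leaf Fo⊕a⊕b⊑ Foa (≤-trans (≤-reflexive (trans (hb _ Fo⊕a⊕b⊑) (cong ((Fo ⊕ δ a ⊕ δ b) a +_) x∉)))
                            (≤-trans (≤-reflexive (+-identityʳ _)) (⊑-trans Fo⊕a⊕b⊑ bV a)))))
        where
        x∈A = ⊑1 I⊑V bA x∈I
        x∉ : (Fo ⊕ δ a ⊕ δ b) x ≡ 0
        x∉ = cong₂ _+_ (cong₂ _+_ (cong₂ _∸_ x∈A x∈I) (δ-other (A≢a x∈A))) (δ-other (A≢b x∈A))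
      conclude (inj₁ v∉I) (inj₁ x∉I) = record
        { I = I ⊕ δ a
        ; I⊑V = λ i → ≤-trans (+-mono-≤ (I⊑V i) (m≤m+n (δ a i) (δ b i))) (≤-reflexive (A⊕pair i))
        ; I-U = λ y h → [ (λ p → proj₂ (free y p)) , (λ p → subst (λ z → t z ≡ U) (δ1 p) ta) ]′ (∈-⊕ h)
        ; indep = λ y h → [ (λ p → trans (far y (⊑1 I⊑V bA p) λ { refl → 1≢0 p v∉I }) (indep y p))
                          , (λ p → subst (λ z → row z (I ⊕ δ a) ≡ 0) (δ1 p) ata) ]′ (∈-⊕ h)
        ; sparse = λ y h → place y h (λ y → row y (I ⊕ δ a) ≤ 1) (nearA y) (≤-trans (≤-reflexive ata) z≤n)
                     (≤-trans (≤-reflexive (trans (row-⊕ b I (δ a)) (cong₂ _+_ (trans rowb x∉I) (row-δ b a)))) (e-bit b a))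
        ; avoid = λ y h → place y h (λ y → t y ≡ N → row y (I ⊕ δ a) ≡ 0)
                    (λ p q → trans (far y p λ { refl → tv q }) (avoid y p (forceF-N (row y (δ v)) q))) (λ _ → ata) (λ q → ⊥-elim (tb q))
        ; forest = Forest-mono V⊑ Fob }
        where
        far : ∀ y → A y ≡ 1 → y ≢ v → row y (I ⊕ δ a) ≡ row y I
        far y p ne = trans (row-⊕ y I (δ a)) (trans (cong (row y I +_) (trans (row-δ y a) (trans (e-sym y a) (trans (eaδ y (⊑1 A⊑V bV p))
          (cong₂ _+_ (δ-other ne) (δ-other λ q → A≢b p (sym q))))))) (+-identityʳ _))
        ata : row a (I ⊕ δ a) ≡ 0
        ata = trans (row-⊕ a I (δ a)) (cong₂ _+_ (trans rowa v∉I) (trans (row-δ a a) (e-irr a)))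
        nearA : ∀ y → A y ≡ 1 → row y (I ⊕ δ a) ≤ 1
        nearA y p with y ≟ v
        ... | no ne = ≤-trans (≤-reflexive (far y p ne)) (sparse y p)
        ... | yes refl = ≤-trans (≤-reflexive (trans (row-⊕ y I (δ a)) (cong₂ _+_ (row-zero bI (λ z q → proj₁ (free z q)) (δ-self y)) (row-δ y a)))) (e-bit y a)
        V⊑ : V ∖ (I ⊕ δ a) ⊑ Fo ⊕ δ b
        V⊑ i = begin
          V i ∸ (I i + δ a i)                      ≡⟨ cong (_∸ (I i + δ a i)) (sym (A⊕pair i)) ⟩
          A i + (δ a i + δ b i) ∸ (I i + δ a i)    ≤⟨ ⊕-∖ {R = δ a ⊕ δ b} I⊑V (λ j → m≤m+n (δ a j) (δ b j)) i ⟩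
          Fo i + (δ a i + δ b i ∸ δ a i)           ≡⟨ cong (Fo i +_) (m+n∸m≡n (δ a i) (δ b i)) ⟩
          Fo i + δ b i                             ∎
          where open ≤-Reasoning

-- A set A of potential at most 1 is coloured first; its forest part is then
-- contracted to a single vertex m of type N.
module Collapse {n} (G : Adj n) {A O : Pt n} (bV : Bit (A ⊕ O)) (t : Fin n → Ty)
                (good : Net.Good G (A ⊕ O) t) (low : W t A ≤ 1 + 2 * Net.D G A) {a : Fin n} (a∈ : A a ≡ 1) where
  open Net G

  private
    bA : Bit A
    bA i = ≤-trans (m≤m+n (A i) (O i)) (bV i)
    bO : Bit O
    bO i = ≤-trans (m≤n+m (O i) (A i)) (bV i)

    A∉O : ∀ {x} → A x ≡ 1 → O x ≡ 0
    A∉O {x} h with bit (bO x)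
    ... | inj₁ q = q
    ... | inj₂ q = ⊥-elim (1+n≰n (≤-trans (≤-reflexive (sym (cong₂ _+_ h q))) (bV x)))

    -- Since ρ(A) ≤ 1 ≤ ρ(A ∪ S), adding `S` to `A` never lowers the potential. For one vertex this
    -- says that 4 times its number of neighbours in `A` is at most its weight: at most one
    -- neighbour, and none for type N.
    outside : ∀ S → S ⊑ O → 2 * D S + 4 * B S A ≤ W t S
    outside S S⊑ = arith (W t S) (W t A) (D S) (D A) (B S A)
      (≤-trans (≤-reflexive (cong (λ z → 1 + 2 * z) (sym (trans (D-⊕ A S) (cong (λ z → D A + D S + 2 * z) (B-comm A S))))))
      (≤-trans (good (A ⊕ S) (λ i → +-monoʳ-≤ (A i) (S⊑ i)) a (trans (cong₂ _+_ a∈ (⊑0 S⊑ (A∉O a∈))) refl)) (≤-reflexive (dot-⊕ _ A S)))) low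
      where
      arith : ∀ ws wa ds da b → 1 + 2 * (da + ds + 2 * b) ≤ wa + ws → wa ≤ 1 + 2 * da → 2 * ds + 4 * b ≤ ws
      arith ws wa ds da b h₁ h₂ = lin 0 (h₁ ⊞ h₂) (solve (ws ∷ wa ∷ ds ∷ da ∷ b ∷ []))

    4row≤w : ∀ x → O x ≡ 1 → 4 * row x A ≤ w (t x)
    4row≤w x h = ≤-trans (≤-trans (≤-reflexive (cong (4 *_) (sym (B-δˡ x A)))) (m≤n+m _ (2 * D (δ x))))
      (≤-trans (outside (δ x) (δ-⊑ h)) (≤-reflexive (dot-δ _ x)))

    rowA≤1 : ∀ x → O x ≡ 1 → row x A ≤ 1
    rowA≤1 x h = below (row x A) (≤-trans (4row≤w x h) (w≤5 (t x)))
      where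
      below : ∀ k → 4 * k ≤ 5 → k ≤ 1
      below k h = ≮⇒≥ λ (q : 2 ≤ k) → absurd-lin 2 (h ⊞ 4 ⊠ q) (solve (k ∷ []))

    rowA-N : ∀ x → O x ≡ 1 → t x ≡ N → row x A ≡ 0
    rowA-N x h q = below (row x A) (≤-trans (4row≤w x h) (≤-reflexive (cong w q)))
      where
      below : ∀ k → 4 * k ≤ 2 → k ≡ 0
      below k h = n<1⇒n≡0 (≰⇒> λ (q : 1 ≤ k) → absurd-lin 1 (h ⊞ 4 ⊠ q) (solve (k ∷ [])))

    A≗δ⇒⊥ : (∀ i → (A ∖ δ a) i ≡ 0) → ⊥
    A≗δ⇒⊥ q = 1+n≰n (≤-trans (2≤w (t a)) (≤-trans (≤-reflexive (sym (dot-δ _ a)))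
        (≤-trans (≤-reflexive (dot-congʳ _ (λ i → sym (A≗δ i)))) (≤-trans low (≤-reflexive (cong (λ z → 1 + 2 * z) (trans (D-cong A≗δ) (D-δ a))))))))
      where
      A≗δ : ∀ i → A i ≡ δ a i
      A≗δ i = trans (split (δ-⊑ {X = A} a∈) i) (trans (cong (δ a i +_) (q i)) (+-identityʳ _))

  -- A single vertex has potential at least 2. This is what makes the contracted graph smaller.
  size-A : 2 ≤ size A
  size-A with Empty? (⊑-trans (∖-⊑ A (δ a)) bA)
  ... | inj₁ q = ⊥-elim (A≗δ⇒⊥ q)
  ... | inj₂ (y , q) =
    ≤-trans (+-mono-≤ (≤-reflexive (sym (size-δ a))) (size≥1 {X = A ∖ δ a} q)) (≤-reflexive (sym (dot-split full (δ-⊑ a∈))))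

  -- If all of `A` were in `I`, it would span no edge and consist of vertices of weight 5,
  -- contradicting `low`. The vertex found will serve as the contracted vertex, so that the vertex
  -- type stays `Fin n`.
  forest-nonempty : (c : Col A t) → ∃ λ m → (A ∖ Col.I c) m ≡ 1
  forest-nonempty c = find (Empty? (⊑-trans (∖-⊑ A I) bA))
    where
    open Col c
    find : (∀ i → (A ∖ I) i ≡ 0) ⊎ (∃ λ m → (A ∖ I) m ≡ 1) → ∃ λ m → (A ∖ I) m ≡ 1
    find (inj₂ p) = p
    find (inj₁ q) = ⊥-elim (1+n≰n (≤-trans (s≤s (s≤s z≤n)) (≤-trans (≤-reflexive (sym (cong w (I-U a (trans (sym (A≗I a)) a∈)))))
        (≤-trans (term≤dot (λ i → w (t i)) a∈) (≤-trans low (≤-reflexive (cong (λ z → 1 + 2 * z) DA)))))))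
      where
      A≗I : ∀ i → A i ≡ I i
      A≗I i = trans (split I⊑V i) (trans (cong (I i +_) (q i)) (+-identityʳ _))
      DA : D A ≡ 0
      DA = trans (D-cong A≗I) (dot-zeroˡ (⊑-trans I⊑V bA) indep)

  module Contract (c : Col A t) {m} (m∈ : (A ∖ Col.I c) m ≡ 1) where
    open Col c

    private
      FA : Pt n
      FA = A ∖ I

      FA⊑A : FA ⊑ A
      FA⊑A = ∖-⊑ A I

      m∉O : O m ≡ 0
      m∉O = A∉O (⊑1 FA⊑A bA m∈)

      O≢m : ∀ {x} → O x ≡ 1 → m ≢ x
      O≢m h refl = 1≢0 h m∉O

      δm-O : ∀ {x} → O x ≡ 1 → δ m x ≡ 0
      δm-O h = δ-other (O≢m h)

      row-A : ∀ x → row x A ≡ row x I + row x FA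
      row-A x = dot-split (e x) I⊑V

      -- Products act as conjunctions. The multiplicity of an edge at `m` is `row y FA`, which is at
      -- most 1 outside `A`; so the contraction is again a simple graph.
      e′ : Fin n → Pt n
      e′ x y = O x * O y * e x y + (δ m x * O y * row y FA + O x * δ m y * row x FA)

      e′-OO : ∀ {x y} → O x ≡ 1 → O y ≡ 1 → e′ x y ≡ e x y
      e′-OO {x} {y} p q = trans (cong₂ (λ a b → a * b * e x y + (δ m x * b * row y FA + a * δ m y * row x FA)) p q)
        (trans (cong₂ (λ a b → 1 * 1 * e x y + (a * 1 * row y FA + 1 * b * row x FA)) (δm-O p) (δm-O q)) (simp (e x y)))
        where
        simp : ∀ k → 1 * 1 * k + 0 ≡ k
        simp k = solve (k ∷ [])

      e′-Oz : ∀ {x y} → O x ≡ 1 → O y ≡ 0 → e′ x y ≡ δ m y * row x FA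
      e′-Oz {x} {y} p q = trans (cong₂ (λ a b → a * b * e x y + (δ m x * b * row y FA + a * δ m y * row x FA)) p q)
        (simp (e x y) (δ m x) (row y FA) (δ m y) (row x FA))
        where
        simp : ∀ a b c d f → 1 * 0 * a + (b * 0 * c + 1 * d * f) ≡ d * f
        simp a b c d f = solve (a ∷ b ∷ c ∷ d ∷ f ∷ [])

      e′-zO : ∀ {x y} → O x ≡ 0 → O y ≡ 1 → e′ x y ≡ δ m x * row y FA
      e′-zO {x} {y} p q = trans (cong₂ (λ a b → a * b * e x y + (δ m x * b * row y FA + a * δ m y * row x FA)) p q)
        (simp (e x y) (δ m x) (row y FA) (δ m y) (row x FA))
        where
        simp : ∀ a b c d f → 0 * 1 * a + (b * 1 * c + 0 * d * f) ≡ b * c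
        simp a b c d f = solve (a ∷ b ∷ c ∷ d ∷ f ∷ [])

      e′-zz : ∀ {x y} → O x ≡ 0 → O y ≡ 0 → e′ x y ≡ 0
      e′-zz {x} {y} p q = trans (cong₂ (λ a b → a * b * e x y + (δ m x * b * row y FA + a * δ m y * row x FA)) p q)
        (simp (δ m x) (row y FA))
        where
        simp : ∀ b c → b * 0 * c + 0 ≡ 0
        simp b c = solve (b ∷ c ∷ [])

      rowFA≤1 : ∀ x → O x ≡ 1 → row x FA ≤ 1
      rowFA≤1 x h = ≤-trans (row-mono x FA⊑A) (rowA≤1 x h)

      e′-bit : ∀ x → Bit (e′ x)
      e′-bit x y with bit (bO x) | bit (bO y)
      ... | inj₂ p | inj₂ q = ≤-trans (≤-reflexive (e′-OO p q)) (e-bit x y)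
      ... | inj₂ p | inj₁ q = ≤-trans (≤-reflexive (e′-Oz p q)) (*-mono-≤ (δ-bit m y) (rowFA≤1 x p))
      ... | inj₁ p | inj₂ q = ≤-trans (≤-reflexive (e′-zO p q)) (*-mono-≤ (δ-bit m x) (rowFA≤1 y q))
      ... | inj₁ p | inj₁ q = ≤-trans (≤-reflexive (e′-zz p q)) z≤n

      e′-sym : ∀ x y → e′ x y ≡ e′ y x
      e′-sym x y = trans (cong (λ z → O x * O y * z + (δ m x * O y * row y FA + O x * δ m y * row x FA)) (e-sym x y))
        (swap (O x) (O y) (e y x) (δ m x) (row y FA) (δ m y) (row x FA))
        where
        swap : ∀ a b c d f g h → a * b * c + (d * b * f + a * g * h) ≡ b * a * c + (g * a * h + b * d * f)
        swap a b c d f g h = solve (a ∷ b ∷ c ∷ d ∷ f ∷ g ∷ h ∷ [])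

      e′-irr : ∀ x → e′ x x ≡ 0
      e′-irr x with bit (bO x)
      ... | inj₂ p = trans (e′-OO p p) (e-irr x)
      ... | inj₁ p = e′-zz p p

    G′ : Adj n
    G′ = record { e = e′ ; e-bit = e′-bit ; e-sym = e′-sym ; e-irr = e′-irr }

    module N′ = Net G′

    V′ : Pt n
    V′ = O ⊕ δ m

    -- An outer vertex next to `I` already has its one neighbour in `I`, so it becomes N. The same
    -- type at `m` keeps new members of `I` away from the whole forest part of `A`.
    t′ : Fin n → Ty
    t′ x = forceN (δ m x) (markN I t x)

    private
      row′-O : ∀ {x S} → S ⊑ O → O x ≡ 1 → N′.row x S ≡ row x S
      row′-O S⊑ p = dot-≡ (⊑-trans S⊑ bO) λ y q → e′-OO p (⊑1 S⊑ bO q)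

      row′-m : ∀ {S} → S ⊑ O → N′.row m S ≡ B S FA
      row′-m {S} S⊑ = dot-≡ (⊑-trans S⊑ bO) λ y q →
        trans (e′-zO m∉O (⊑1 S⊑ bO q)) (trans (cong (_* row y FA) (δ-self m)) (*-identityˡ (row y FA)))

      D′-O : ∀ {S} → S ⊑ O → N′.D S ≡ D S
      D′-O S⊑ = dot-≡ (⊑-trans S⊑ bO) λ y q → row′-O S⊑ (⊑1 S⊑ bO q)

      D′-m : ∀ {S} → S ⊑ O → N′.D (S ⊕ δ m) ≡ D S + 2 * B S FA
      D′-m {S} S⊑ = trans (N′.D-⊕δ S m) (cong₂ (λ a b → a + 2 * b) (D′-O S⊑) (row′-m S⊑))

      t′-O : ∀ {x} → O x ≡ 1 → t′ x ≡ markN I t x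
      t′-O {x} p = cong (λ z → forceN z (markN I t x)) (δm-O p)

      t′-m : t′ m ≡ N
      t′-m = forceN-≥1 (markN I t m) (≤-reflexive (sym (δ-self m)))

      W′-O : ∀ {S} → S ⊑ O → W t′ S ≡ W (markN I t) S
      W′-O S⊑ = dot-≡ (⊑-trans S⊑ bO) λ y q → cong w (t′-O (⊑1 S⊑ bO q))

      B-A : ∀ S → B S A ≡ B S I + B S FA
      B-A S = trans (form-cong e (λ _ → refl) (split I⊑V)) (form-⊕ʳ e S I FA)

      -- By `outside` every edge to `I` is worth 4, and marking its end costs at most 3; one unit is
      -- left.
      drop : ∀ {S} → S ⊑ O → 2 * D S + B S I + 4 * B S FA ≤ W t′ S
      drop {S} S⊑ = ≤-trans (arith (D S) (B S I) (B S FA) (W t S) (W (markN I t) S)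
          (≤-trans (≤-reflexive (cong (λ z → 2 * D S + 4 * z) (sym (B-A S)))) (outside S S⊑)) (W-markN I t S))
        (≤-reflexive (sym (W′-O S⊑)))
        where
        arith : ∀ d i f a b → 2 * d + 4 * (i + f) ≤ a → a ≤ b + 3 * i → 2 * d + i + 4 * f ≤ b
        arith d i f a b h₁ h₂ = lin 0 (h₁ ⊞ h₂) (solve (d ∷ i ∷ f ∷ a ∷ b ∷ []))

      good-O : ∀ {S s} → S ⊑ O → S s ≡ 1 → 1 + 2 * D S ≤ W t′ S
      good-O {S} {s} S⊑ s∈ = go (B S I) refl
        where
        go : ∀ k → B S I ≡ k → 1 + 2 * D S ≤ W t′ S
        go zero q = ≤-trans (good S (λ i → ≤-trans (S⊑ i) (m≤n+m (O i) (A i))) s s∈)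
          (≤-trans (W-markN I t S) (≤-reflexive (trans (cong (λ z → W (markN I t) S + 3 * z) q) (trans (+-identityʳ _) (sym (W′-O S⊑))))))
        go (suc k) q = arith (D S) (B S I) (B S FA) (W t′ S) (drop S⊑) (≤-trans (s≤s z≤n) (≤-reflexive (sym q)))
          where
          arith : ∀ d i f a → 2 * d + i + 4 * f ≤ a → 1 ≤ i → 1 + 2 * d ≤ a
          arith d i f a h₁ h₂ = lin (4 * f) (h₁ ⊞ h₂) (solve (d ∷ i ∷ f ∷ a ∷ []))

      -- The 2 is the weight of the contracted vertex: by `drop` the rest has nonnegative potential
      -- even after its edges to `m` are charged.
      good-m : ∀ {S} → S ⊑ O → 1 + 2 * (D S + 2 * B S FA) ≤ W t′ S + 2
      good-m {S} S⊑ = arith (D S) (B S I) (B S FA) (W t′ S) (drop S⊑)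
        where
        arith : ∀ d i f a → 2 * d + i + 4 * f ≤ a → 1 + 2 * (d + 2 * f) ≤ a + 2
        arith d i f a h = lin (1 + i) h (solve (d ∷ i ∷ f ∷ a ∷ []))

      ⊑O : ∀ {S} → S ⊑ V′ → S m ≡ 0 → S ⊑ O
      ⊑O S⊑ q i with m ≟ i
      ... | yes refl = ≤-trans (≤-reflexive q) z≤n
      ... | no ne = ≤-trans (S⊑ i) (≤-reflexive (trans (cong (O i +_) (δ-other ne)) (+-identityʳ (O i))))

    V′-bit : Bit V′
    V′-bit i with m ≟ i
    ... | yes refl = ≤-reflexive (cong₂ _+_ m∉O (δ-self m))
    ... | no ne = ≤-trans (≤-reflexive (trans (cong (O i +_) (δ-other ne)) (+-identityʳ (O i)))) (bO i)

    size-V′ : size V′ < size (A ⊕ O)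
    size-V′ = arith (size A) (size O) (trans (dot-⊕ full O (δ m)) (cong (size O +_) (size-δ m))) (dot-⊕ full A O) size-A
      where
      arith : ∀ {x y} a o → x ≡ o + 1 → y ≡ a + o → 2 ≤ a → suc x ≤ y
      arith a o refl refl h = lin 0 h (solve (a ∷ o ∷ []))

    good′ : N′.Good V′ t′
    good′ S S⊑ s s∈ = go (bit (⊑-trans S⊑ V′-bit m))
      where
      go : S m ≡ 0 ⊎ S m ≡ 1 → 1 + 2 * N′.D S ≤ W t′ S
      go (inj₁ q) = ≤-trans (≤-reflexive (cong (λ z → 1 + 2 * z) (D′-O (⊑O S⊑ q)))) (good-O (⊑O S⊑ q) s∈)
      go (inj₂ q) = ≤-trans (≤-reflexive (cong (λ z → 1 + 2 * z) (trans (N′.D-cong S≗) (D′-m T⊑))))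
        (≤-trans (good-m T⊑) (≤-reflexive (trans (cong (W t′ T +_) (sym (trans (dot-δ _ m) (cong w t′-m)))) (trans (sym (dot-⊕ _ T (δ m))) (dot-congʳ _ (λ i → sym (S≗ i)))))))
        where
        T : Pt n
        T = S ∖ δ m
        S≗ : ∀ i → S i ≡ (T ⊕ δ m) i
        S≗ i = trans (split (δ-⊑ {X = S} q) i) (+-comm (δ m i) (T i))
        T⊑ : T ⊑ O
        T⊑ = ⊑O (⊑-trans (∖-⊑ S (δ m)) S⊑) (cong₂ _∸_ q (δ-self m))

    -- New members of `I` have no neighbour in `A`: neighbours of `I` have type N, and neighbours of
    -- the forest part are adjacent to `m` of type N. For the forest, edges from `Q` to the part `P`
    -- of `A` number at most those from `Q` to `m`; so the bound for `Q` together with `m`, added to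
    -- the bound for `P`, undoes the contraction.
    collapse-glue : N′.Col V′ t′ → Col (A ⊕ O) t
    collapse-glue d = record
      { I = J
      ; I⊑V = λ i → +-mono-≤ (I⊑V i) (I′⊑O i)
      ; I-U = λ x h → [ I-U x , (λ p → proj₂ (proj₂ (free x p))) ]′ (∈-⊕ h)
      ; indep = λ x h → [ (λ p → trans (atA (⊑1 I⊑V bA p)) (indep x p))
                        , (λ p → both x (proj₁ (proj₂ (free x p))) (trans (sym (row′-O I′⊑O (⊑1 I′⊑O bO p))) (E.indep x p))) ]′ (∈-⊕ h)
      ; sparse = λ x h → [ (λ p → ≤-trans (≤-reflexive (atA p)) (sparse x p)) , (λ p → sparseO x p (row x I) refl) ]′ (∈-⊕ h)
      ; avoid = λ x h q → [ (λ p → trans (atA p) (avoid x p q))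
                          , (λ p → both x (n≤0⇒n≡0 (≤-trans (row-mono x I⊑V) (≤-reflexive (rowA-N x p q))))
                                     (avoidO x p (trans (t′-O p) (forceN-N (row x I) q)))) ]′ (∈-⊕ h)
      ; forest = Forest-mono (⊕-∖ I⊑V I′⊑O)
          (forest-⊕ (λ i → ≤-trans (+-mono-≤ (FA⊑A i) (∖-⊑ O I′ i)) (bV i)) forest FO
            λ P Q p q x y hx hy → arith (D P) (D Q) (B P Q) (B Q FA) (size P) (size Q)
              (≤-trans (form-mono e p (λ _ → ≤-refl)) (≤-reflexive (B-comm FA Q)))
              (forest P p x hx) (spine Q q)) }
      where
      module E = N′.Col d
      I′ J : Pt n
      I′ = E.I
      J = I ⊕ I′
      N≢U : N ≢ U
      N≢U ()
      bI′ : Bit I′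
      bI′ = ⊑-trans E.I⊑V V′-bit
      m∉I′ : I′ m ≡ 0
      m∉I′ = [ (λ p → p) , (λ p → ⊥-elim (N≢U (trans (sym t′-m) (E.I-U m p)))) ]′ (bit (bI′ m))
      I′⊑O : I′ ⊑ O
      I′⊑O = ⊑O E.I⊑V m∉I′
      free : ∀ x → I′ x ≡ 1 → δ m x ≡ 0 × row x I ≡ 0 × t x ≡ U
      free x p with forceN-U (δ m x) (E.I-U x p)
      ... | q , r = q , forceN-U (row x I) r
      V′m : V′ m ≡ 1
      V′m = cong₂ _+_ m∉O (δ-self m)
      freeF : ∀ x → I′ x ≡ 1 → row x FA ≡ 0
      freeF x = dot≡0 (trans (sym (row′-m I′⊑O)) (E.avoid m V′m t′-m))
      crossA : ∀ {x} → A x ≡ 1 → row x I′ ≡ 0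
      crossA = row-zero bI′ λ y p → trans (row-A y) (cong₂ _+_ (proj₁ (proj₂ (free y p))) (freeF y p))
      both : ∀ x → row x I ≡ 0 → row x I′ ≡ 0 → row x J ≡ 0
      both x p q = trans (row-⊕ x I I′) (cong₂ _+_ p q)
      atA : ∀ {x} → A x ≡ 1 → row x J ≡ row x I
      atA {x} p = trans (row-⊕ x I I′) (trans (cong (row x I +_) (crossA p)) (+-identityʳ _))
      O⊑V′ : O ⊑ V′
      O⊑V′ i = m≤m+n (O i) (δ m i)
      avoidO : ∀ x → O x ≡ 1 → t′ x ≡ N → row x I′ ≡ 0
      avoidO x p q = trans (sym (row′-O I′⊑O p)) (E.avoid x (⊑1 O⊑V′ V′-bit p) q)
      sparseO : ∀ x → O x ≡ 1 → ∀ k → row x I ≡ k → row x J ≤ 1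
      sparseO x p zero q = ≤-trans (≤-reflexive (trans (row-⊕ x I I′) (trans (cong (_+ row x I′) q) (sym (row′-O I′⊑O p))))) (E.sparse x (⊑1 O⊑V′ V′-bit p))
      sparseO x p (suc k) q = ≤-trans (≤-reflexive (trans (row-⊕ x I I′) (trans (cong (row x I +_)
          (avoidO x p (trans (t′-O p) (forceN-≥1 (t x) (≤-trans (s≤s z≤n) (≤-reflexive (sym q))))))) (+-identityʳ _))))
        (≤-trans (row-mono x I⊑V) (rowA≤1 x p))
      FO⊑ : ∀ {Q} → Q ⊑ (O ∖ I′) → Q ⊕ δ m ⊑ (V′ ∖ I′)
      FO⊑ {Q} q i with m ≟ i
      ... | yes refl = ≤-reflexive (trans (cong₂ _+_ (⊑0 {X = Q} (⊑-trans q (∖-⊑ O I′)) m∉O) (δ-self m)) (sym (cong₂ _∸_ V′m m∉I′)))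
      ... | no ne = ≤-trans (≤-reflexive (trans (cong (Q i +_) (δ-other ne)) (+-identityʳ (Q i)))) (≤-trans (q i) (∸-monoˡ-≤ (I′ i) (O⊑V′ i)))
      FO : Forest (O ∖ I′)
      FO S S⊑ s s∈ = ≤-trans (≤-reflexive (cong (_+ 2) (sym (D′-O (⊑-trans S⊑ (∖-⊑ O I′))))))
        (E.forest S (λ i → ≤-trans (m≤m+n (S i) (δ m i)) (FO⊑ S⊑ i)) s s∈)
      spine : ∀ Q → Q ⊑ (O ∖ I′) → D Q + 2 * B Q FA + 2 ≤ 2 * (size Q + 1)
      spine Q q = ≤-trans (≤-reflexive (cong (_+ 2) (sym (D′-m (⊑-trans q (∖-⊑ O I′))))))
        (≤-trans (E.forest (Q ⊕ δ m) (FO⊑ q) m (cong₂ _+_ (⊑0 {X = Q} (⊑-trans q (∖-⊑ O I′)) m∉O) (δ-self m)))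
                 (≤-reflexive (cong (2 *_) (trans (dot-⊕ full Q (δ m)) (cong (size Q +_) (size-δ m))))))
      arith : ∀ dp dq b c p q → b ≤ c → dp + 2 ≤ 2 * p → dq + 2 * c + 2 ≤ 2 * (q + 1) → dp + dq + 2 * b + 2 ≤ 2 * (p + q)
      arith dp dq b c p q h₁ h₂ h₃ = lin 0 (2 ⊠ h₁ ⊞ h₂ ⊞ h₃) (solve (dp ∷ dq ∷ b ∷ c ∷ p ∷ q ∷ []))

-- A minimal counterexample

thinN u₂N : Ty → ℕ → ℕ
thinN N d = 0
thinN U 2 = 1
thinN U d = 0
thinN F 2 = 1
thinN F d = 0
u₂N U 2 = 1
u₂N τ d = 0

thinN-bit : ∀ τ d → thinN τ d ≤ 1
thinN-bit N d = z≤n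
thinN-bit U 0 = z≤n
thinN-bit U 1 = z≤n
thinN-bit U 2 = ≤-refl
thinN-bit U (suc (suc (suc d))) = z≤n
thinN-bit F 0 = z≤n
thinN-bit F 1 = z≤n
thinN-bit F 2 = ≤-refl
thinN-bit F (suc (suc (suc d))) = z≤n

thinN-1 : ∀ τ d → thinN τ d ≡ 1 → τ ≢ N × d ≡ 2
thinN-1 U 2 h = (λ ()) , refl
thinN-1 F 2 h = (λ ()) , refl

thinN-3 : ∀ τ → thinN τ 3 ≡ 0
thinN-3 U = refl
thinN-3 F = refl
thinN-3 N = refl

u₂N-bit : ∀ τ d → u₂N τ d ≤ 1
u₂N-bit U 0 = z≤n
u₂N-bit U 1 = z≤n
u₂N-bit U 2 = ≤-refl
u₂N-bit U (suc (suc (suc d))) = z≤n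
u₂N-bit F d = z≤n
u₂N-bit N d = z≤n

u₂N-1 : ∀ τ d → u₂N τ d ≡ 1 → τ ≡ U × d ≡ 2
u₂N-1 U 2 h = refl , refl

module Minimal {n} (G : Adj n) {V : Pt n} (bV : Bit V) (t : Fin n → Ty) (good : Net.Good G V t)
               (ih : ∀ (G′ : Adj n) V′ t′ → Bit V′ → size V′ < size V → Net.Good G′ V′ t′ → ¬ ¬ Net.Col G′ V′ t′)
               (¬col : ¬ Net.Col G V t) where
  open Net G

  size-< : ∀ {S y} → S ⊑ V → V y ≡ 1 → S y ≡ 0 → size S < size V
  size-< {S} {y} S⊑ y∈ y∉ = ≤-trans (≤-reflexive (+-comm 1 (size S)))
    (≤-trans (+-monoʳ-≤ (size S) (size≥1 {X = V ∖ S} (∈-∖⁺ {X = V} {S} y∈ y∉))) (≤-reflexive (sym (dot-split full S⊑))))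

  potential≥2 : Potential≥2 V t
  potential≥2 S S⊑ x x∈ y y∈ y∉ with 2 + 2 * D S ≤? W t S
  ... | yes h = h
  ... | no h = ⊥-elim (ih G S t (⊑-trans S⊑ bV) (size-< S⊑ y∈ y∉) (λ T T⊑ → good T (⊑-trans T⊑ S⊑)) finish)
    where
    V≗ : ∀ i → V i ≡ (S ⊕ (V ∖ S)) i
    V≗ = split S⊑
    ⊑V : S ⊕ (V ∖ S) ⊑ V
    ⊑V i = ≤-reflexive (sym (V≗ i))
    open Collapse G (⊑-trans ⊑V bV) t (λ T T⊑ → good T (⊑-trans T⊑ ⊑V)) (≤-pred (≰⇒> h)) x∈
    finish : ¬ Col S t
    finish c with forest-nonempty c
    ... | m , m∈ = ih G′ V′ t′ V′-bit (≤-trans size-V′ (≤-reflexive (dot-congʳ full (λ i → sym (V≗ i))))) good′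
                     λ d → ¬col (Col-cong (λ i → sym (V≗ i)) (collapse-glue d))
      where open Contract c m∈

  -- With at most one crossing edge, marking its ends costs a set on either side at most 1, which
  -- its potential of at least 2 can pay. Then both sides are coloured and glued.
  two-edges : ∀ {S x y} → S ⊑ V → S x ≡ 1 → V y ≡ 1 → S y ≡ 0 → 2 ≤ B S (V ∖ S)
  two-edges {S} {x} {y} S⊑ x∈ y∈ y∉ with 2 ≤? B S (V ∖ S)
  ... | yes h = h
  ... | no h = ⊥-elim (ih G S (markF O t) (⊑-trans S⊑ bV) (size-< S⊑ y∈ y∉) (good-markF λ T T⊑ z z∈ →
                 side T T⊑ S⊑ z z∈ y∈ y∉ few) λ c →
               ih G O (markF S t) (⊑-trans O⊑ bV) (size-< O⊑ (⊑1 S⊑ bV x∈) x∉O) (good-markF λ T T⊑ z z∈ →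
                 side T T⊑ O⊑ z z∈ (⊑1 S⊑ bV x∈) x∉O (≤-trans (≤-reflexive (B-comm O S)) few)) λ d →
               ¬col (Col-cong (λ i → sym (V≗ i)) (cut-glue few c d)))
    where
    O : Pt n
    O = V ∖ S
    O⊑ : O ⊑ V
    O⊑ = ∖-⊑ V S
    V≗ : ∀ i → V i ≡ (S ⊕ O) i
    V≗ = split S⊑
    open Cut G {S} {O} (λ i → ≤-trans (≤-reflexive (sym (V≗ i))) (bV i)) t
    few : B S O ≤ 1
    few = ≤-pred (≰⇒> h)
    x∉O : O x ≡ 0
    x∉O = cong₂ _∸_ (⊑1 S⊑ bV x∈) x∈
    side : ∀ T {A X y} → T ⊑ A → A ⊑ V → ∀ z → T z ≡ 1 → V y ≡ 1 → A y ≡ 0 → B A X ≤ 1 → 1 + 2 * D T + B T X ≤ W t T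
    side T {A} {X} {y} T⊑ A⊑ z z∈ y∈ y∉ f = ≤-trans (+-monoʳ-≤ (1 + 2 * D T) (≤-trans (form-mono e T⊑ (λ _ → ≤-refl)) f))
      (≤-trans (≤-reflexive (+-comm (1 + 2 * D T) 1)) (potential≥2 T (⊑-trans T⊑ A⊑) z z∈ y y∈ (⊑0 T⊑ y∉)))

  -- A lone vertex is coloured by putting it into F. So singletons are proper subsets and fall under
  -- `two-edges`, which gives the degree bound.
  another : ∀ {x} → V x ≡ 1 → ∃ λ y → V y ≡ 1 × δ x y ≡ 0
  another {x} x∈ with Empty? (⊑-trans (∖-⊑ V (δ x)) bV)
  ... | inj₂ (y , h) = y , ∈-∖ {Y = δ x} bV h
  ... | inj₁ h = ⊥-elim (¬col record
      { I = ∅ ; I⊑V = λ _ → z≤n ; I-U = λ _ () ; indep = λ _ () ; sparse = λ y _ → ≤-trans (≤-reflexive (dot-∅ (e y))) z≤n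
      ; avoid = λ y _ _ → dot-∅ (e y)
      ; forest = λ S S⊑ s s∈ → sparse-forest (⊑-trans S⊑ bV) s∈ (≤-trans (D-mono S⊑) (≤-trans (≤-reflexive (trans (D-cong V≗δ) (D-δ x))) z≤n)) })
    where
    V≗δ : ∀ i → V i ≡ δ x i
    V≗δ i = trans (split (δ-⊑ {X = V} x∈) i) (trans (cong (δ x i +_) (h i)) (+-identityʳ _))

  degree≥2 : ∀ {x} → V x ≡ 1 → 2 ≤ row x V
  degree≥2 {x} x∈ with another x∈
  ... | y , y∈ , y∉ = ≤-trans (two-edges (δ-⊑ x∈) (δ-self x) y∈ y∉)
                        (≤-trans (≤-reflexive (B-δˡ x _)) (row-mono x (∖-⊑ V (δ x))))

  row-without : ∀ {x y S} → S ⊑ V → V y ≡ 1 → S y ≡ 0 → e x y ≡ 1 → row x S + 1 ≤ row x V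
  row-without {x} {y} {S} S⊑ y∈ y∉ h = ≤-trans (+-monoʳ-≤ (row x S) (≤-trans (≤-reflexive (sym h)) (edge⇒row {X = V ∖ S} (∈-∖⁺ {X = V} {S} y∈ y∉))))
    (≤-reflexive (sym (dot-split (e x) S⊑)))

  star-excluded : ∀ {v} → V v ≡ 1 → t v ≡ U → 3 ≤ row v V → ¬ (∀ j → V j ≡ 1 → e v j ≡ 1 → t j ≡ U × row j V ≡ 2)
  star-excluded {v} v∈ tv deg nbr = ih G (A v∈ tv nbr) _ (⊑-trans A⊑V bV)
      (size-< A⊑V v∈ (cong₂ _∸_ v∈ (cong₂ _+_ (δ-self v) (cong (_* V v) (e-irr v)))))
      (star-good v∈ tv nbr good potential≥2 deg) λ c → ¬col (star-glue v∈ tv nbr c)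
    where
    open Star G bV t
    A⊑V : V ∖ (δ v ⊕ e v ⊓ V) ⊑ V
    A⊑V = ∖-⊑ V (δ v ⊕ e v ⊓ V)

  neighbours₂ : ∀ {a v} → row a V ≡ 2 → V v ≡ 1 → e a v ≡ 1 →
                ∃ λ b → V b ≡ 1 × e a b ≡ 1 × (∀ S → S ⊑ V → row a S ≡ S v + S b)
  neighbours₂ {a} {v} deg v∈ av with row≥1 {X = V ∖ δ v} (⊑-trans (∖-⊑ V (δ v)) bV) (≤-reflexive (sym r₁))
    where
    r₁ : row a (V ∖ δ v) ≡ 1
    r₁ = +-cancelˡ-≡ 1 _ _ (trans (cong (_+ row a (V ∖ δ v)) (sym (trans (row-δ a v) av))) (trans (sym (dot-split (e a) (δ-⊑ v∈))) deg))
  ... | b , b∈R , ab with ∈-∖ {Y = δ v} bV b∈R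
  ... | b∈ , v≢b = b , b∈ , ab , λ S S⊑ → trans (dot-≡ {f = e a} {g = δ v ⊕ δ b} (⊑-trans S⊑ bV) λ i i∈ → nbr i (⊑1 S⊑ bV i∈))
      (trans (dot-⊕ˡ (δ v) (δ b) S) (cong₂ _+_ (dot-δˡ S v) (dot-δˡ S b)))
    where
    R : Pt n
    R = V ∖ (δ v ⊕ δ b)
    pair⊑ : δ v ⊕ δ b ⊑ V
    pair⊑ i with v ≟ i
    ... | yes refl = ≤-reflexive (trans (cong₂ _+_ (δ-self v) (δ-other λ { refl → 1≢0 (δ-self v) v≢b })) (sym v∈))
    ... | no ne = ≤-trans (≤-reflexive (cong (_+ δ b i) (δ-other ne))) (δ-⊑ b∈ i)
    rR : row a R ≡ 0
    rR = +-cancelˡ-≡ 2 _ _ (trans (cong (_+ row a R) (sym (trans (row-⊕ a (δ v) (δ b)) (cong₂ _+_ (trans (row-δ a v) av) (trans (row-δ a b) ab)))))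
           (trans (sym (dot-split (e a) pair⊑)) deg))
    nbr : ∀ i → V i ≡ 1 → e a i ≡ δ v i + δ b i
    nbr i i∈ with ∈-split pair⊑ i∈
    ... | inj₂ p = trans (row≡0 rR p) (sym (proj₂ (∈-∖ {Y = δ v ⊕ δ b} bV p)))
    ... | inj₁ p with ∈-⊕ {δ v i} p
    ... | inj₁ q = trans (subst (λ z → e a z ≡ 1) (δ1 q) av) (sym p)
    ... | inj₂ q = trans (subst (λ z → e a z ≡ 1) (δ1 q) ab) (sym p)

  -- Thin vertices, path reductions and tight sets

  record Thin (x : Fin n) : Set where
    constructor thin
    field
      type   : t x ≢ N
      degree : row x V ≡ 2

  record U₂ (x : Fin n) : Set where
    constructor u₂
    field
      type   : t x ≡ U
      degree : row x V ≡ 2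

  record Tight (T : Pt n) : Set where
    field
      within : T ⊑ V
      some   : ∃ λ x → T x ≡ 1
      miss   : ∃ λ y → V y ≡ 1 × T y ≡ 0
      tight  : W t T ≤ 2 + 2 * D T

  record Path (v a b : Fin n) : Set where
    field
      v∈ : V v ≡ 1
      a∈ : V a ≡ 1
      b∈ : V b ≡ 1
      Ua : U₂ a
      tb : Thin b
      tv : t v ≢ N
      va : e a v ≡ 1
      ab : e a b ≡ 1
      na : ∀ S → S ⊑ V → row a S ≡ S v + S b

  path-bound : ∀ {v a b} → Path v a b → ¬ (∀ S → S ⊑ V → S a ≡ 0 → ∀ s → S s ≡ 1 → 1 + 2 * D S + row v S ≤ W t S)
  path-bound {v} {a} {b} p h with neighbours₂ {b} {a} (Thin.degree tb) a∈ (trans (e-sym b a) ab)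
    where open Path p
  ... | x , _ , _ , nb = ih G (A a∈ b∈ (U₂.type Ua) (Thin.type tb) tv na nb) _ (⊑-trans A⊑V bV) (size-< A⊑V a∈ a∉A)
      (thread-good a∈ b∈ (U₂.type Ua) (Thin.type tb) tv na nb λ S S⊑ → h S (⊑-trans S⊑ A⊑V) (⊑0 S⊑ a∉A))
      λ c → ¬col (thread-glue a∈ b∈ (U₂.type Ua) (Thin.type tb) tv na nb c)
    where
    open Path p
    open Thread G bV t
    A⊑V : V ∖ (δ a ⊕ δ b) ⊑ V
    A⊑V = ∖-⊑ V (δ a ⊕ δ b)
    a∉A : (V ∖ (δ a ⊕ δ b)) a ≡ 0
    a∉A = trans (cong₂ (λ i j → i ∸ (j + δ b a)) a∈ (δ-self a)) (0∸n≡0 (δ b a))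

  -- One of the two neighbours of `v` is `a`, so a set avoiding `a` pays at most 1 for the marks,
  -- and proper sets have potential at least 2.
  thin-path-excluded : ∀ {v a b} → Path v a b → row v V ≡ 2 → ⊥
  thin-path-excluded {v} {a} p deg = path-bound p λ S S⊑ a∉ s s∈ →
      arith (D S) (row v S) (W t S) (≤-trans (row-without S⊑ a∈ a∉ (trans (e-sym v a) va)) (≤-reflexive deg)) (potential≥2 S S⊑ s s∈ a a∈ a∉)
    where
    open Path p
    arith : ∀ d r x → r + 1 ≤ 2 → 2 + 2 * d ≤ x → 1 + 2 * d + r ≤ x
    arith d r x h₁ h₂ = lin 0 (h₁ ⊞ h₂) (solve (d ∷ r ∷ x ∷ []))

  -- The marks cost `row v S`, at most 2 since `a` is outside `S`; so only a set with ρ(S) ≤ 2 and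
  -- two neighbours of `v` can block the reduction. It contains `v`: otherwise adding `v` would
  -- bring weight at most 5 and cost 8, making the potential negative.
  path-tight : ∀ {v a b} → Path v a b → row v V ≡ 3 → ¬ ¬ ∃ λ T → Tight T × T v ≡ 1 × T a ≡ 0
  path-tight {v} {a} p deg ¬T = path-bound p bound
    where
    open Path p
    bound : ∀ S → S ⊑ V → S a ≡ 0 → ∀ s → S s ≡ 1 → 1 + 2 * D S + row v S ≤ W t S
    bound S S⊑ a∉ s s∈ = go (row v S ≤? 1) (3 + 2 * D S ≤? W t S)
      where
      r≤2 : row v S + 1 ≤ 3
      r≤2 = ≤-trans (row-without S⊑ a∈ a∉ (trans (e-sym v a) va)) (≤-reflexive deg)
      arith₁ : ∀ d r x → r ≤ 1 → 2 + 2 * d ≤ x → 1 + 2 * d + r ≤ x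
      arith₁ d r x h₁ h₂ = lin 0 (h₁ ⊞ h₂) (solve (d ∷ r ∷ x ∷ []))
      arith₂ : ∀ d r x → r + 1 ≤ 3 → 3 + 2 * d ≤ x → 1 + 2 * d + r ≤ x
      arith₂ d r x h₁ h₂ = lin 0 (h₁ ⊞ h₂) (solve (d ∷ r ∷ x ∷ []))
      v∈S : 2 ≤ row v S → W t S ≤ 2 + 2 * D S → S v ≡ 0 ⊎ S v ≡ 1 → S v ≡ 1
      v∈S r≥2 low (inj₂ q) = q
      v∈S r≥2 low (inj₁ q) = contra (D S) (row v S) (W t S) (w (t v))
          (≤-trans (≤-reflexive (cong (λ z → 1 + 2 * z) (sym (D-⊕δ S v)))) (≤-trans (good (S ⊕ δ v) S+v⊑ v (cong₂ _+_ q (δ-self v)))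
                   (≤-reflexive (trans (dot-⊕ _ S (δ v)) (cong (W t S +_) (dot-δ _ v)))))) low r≥2 (w≤5 (t v))
        where
        S+v⊑ : S ⊕ δ v ⊑ V
        S+v⊑ i with v ≟ i
        ... | yes refl = ≤-reflexive (trans (cong₂ _+_ q (δ-self v)) (sym v∈))
        ... | no ne = ≤-trans (≤-reflexive (trans (cong (S i +_) (δ-other ne)) (+-identityʳ (S i)))) (S⊑ i)
        contra : ∀ d r x k {A : Set} → 1 + 2 * (d + 2 * r) ≤ x + k → x ≤ 2 + 2 * d → 2 ≤ r → k ≤ 5 → A
        contra d r x k h₁ h₂ h₃ h₄ = absurd-lin 1 (h₁ ⊞ h₂ ⊞ 4 ⊠ h₃ ⊞ h₄) (solve (d ∷ r ∷ x ∷ k ∷ []))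
      go : Dec (row v S ≤ 1) → Dec (3 + 2 * D S ≤ W t S) → 1 + 2 * D S + row v S ≤ W t S
      go (yes h) _ = arith₁ (D S) (row v S) (W t S) h (potential≥2 S S⊑ s s∈ a a∈ a∉)
      go _ (yes h) = arith₂ (D S) (row v S) (W t S) r≤2 h
      go (no h) (no k) = ⊥-elim (¬T (S , record { within = S⊑ ; some = s , s∈ ; miss = a , a∈ , a∉ ; tight = ≤-pred (≰⇒> k) }
                                        , v∈S (≰⇒> h) (≤-pred (≰⇒> k)) (bit (⊑-trans S⊑ bV v)) , a∉))

  -- Removing `a` from `T` would lose weight 5 but at most one edge, worth 4, leaving potential at
  -- most 1 on a proper set; and {a} alone has potential 5.
  tight-avoids : ∀ {T a v} → Tight T → U₂ a → V a ≡ 1 → V v ≡ 1 → e a v ≡ 1 → T v ≡ 0 → T a ≡ 0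
  tight-avoids {T} {a} {v} tT (u₂ ta deg) a∈ v∈ av v∉ = go (bit (⊑-trans within bV a))
    where
    open Tight tT
    go : T a ≡ 0 ⊎ T a ≡ 1 → T a ≡ 0
    go (inj₁ q) = q
    go (inj₂ q) = ⊥-elim (rest (Empty? (⊑-trans T′⊑V bV)))
      where
      T′ : Pt n
      T′ = T ∖ δ a
      T′⊑T : T′ ⊑ T
      T′⊑T = ∖-⊑ T (δ a)
      T′⊑V : T′ ⊑ V
      T′⊑V = ⊑-trans T′⊑T within
      T≗ : ∀ i → T i ≡ (T′ ⊕ δ a) i
      T≗ i = trans (split (δ-⊑ {X = T} q) i) (+-comm (δ a i) (T′ i))
      DT : D T ≡ D T′ + 2 * row a T′
      DT = trans (D-cong T≗) (D-⊕δ T′ a)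
      WT : W t T ≡ W t T′ + 5
      WT = trans (dot-congʳ _ T≗) (trans (dot-⊕ _ T′ (δ a)) (cong (W t T′ +_) (trans (dot-δ _ a) (cong w ta))))
      r≤1 : row a T′ + 1 ≤ 2
      r≤1 = ≤-trans (row-without T′⊑V v∈ (⊑0 T′⊑T v∉) av) (≤-reflexive deg)
      low : W t T′ + 5 ≤ 2 + 2 * (D T′ + 2 * row a T′)
      low = ≤-trans (≤-reflexive (sym WT)) (≤-trans tight (≤-reflexive (cong (λ z → 2 + 2 * z) DT)))
      contra₀ : ∀ {d r} x → x + 5 ≤ 2 + 2 * (d + 2 * r) → d ≡ 0 → r ≡ 0 → ⊥
      contra₀ x h refl refl = absurd-lin (x + 2) h (solve (x ∷ []))
      contra : ∀ d r x → x + 5 ≤ 2 + 2 * (d + 2 * r) → r + 1 ≤ 2 → 2 + 2 * d ≤ x → ⊥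
      contra d r x h₁ h₂ h₃ = absurd-lin 0 (h₁ ⊞ 4 ⊠ h₂ ⊞ h₃) (solve (d ∷ r ∷ x ∷ []))
      rest : (∀ i → T′ i ≡ 0) ⊎ (∃ λ x → T′ x ≡ 1) → ⊥
      rest (inj₁ h) = contra₀ (W t T′) low (B-∅ˡ h T′) (trans (dot-congʳ (e a) h) (dot-∅ (e a)))
      rest (inj₂ (x , x∈)) = contra (D T′) (row a T′) (W t T′) low r≤1 (potential≥2 T′ T′⊑V x x∈ a a∈ (cong₂ _∸_ q (δ-self a)))

  infixl 6 _∪_
  _∪_ : Pt n → Pt n → Pt n
  X ∪ Y = X ⊕ (Y ∖ (X ⊓ Y))

  -- Submodularity: ρ(T ∪ R) + ρ(T ∩ R) ≤ ρ(T) + ρ(R) ≤ 4, and the intersection contains `z` and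
  -- misses `y`, so its potential is at least 2. The common outsider `y` also keeps the union
  -- proper.
  tight-∪ : ∀ {T R z y} → Tight T → Tight R → T z ≡ 1 → R z ≡ 1 → V y ≡ 1 → T y ≡ 0 → R y ≡ 0 → Tight (T ∪ R)
  tight-∪ {T} {R} {z} {y} tT tR zT zR y∈ yT yR = record
      { within = λ i → ∪-≤ (T.within i) (R.within i) (bV i)
      ; some = z , cong₂ _+_ zT (cong₂ _∸_ zR (cong₂ _*_ zT zR))
      ; miss = y , y∈ , cong₂ _+_ yT (cong₂ _∸_ yR (cong₂ _*_ yT yR))
      ; tight = arith (W t T) (W t C) (W t Q) (D T) (D C) (D Q) (B C Q) (B T Q) T.tight
          (≤-trans (≤-reflexive (sym (dot-split _ C⊑R))) (≤-trans R.tight (≤-reflexive (cong (λ z → 2 + 2 * z) (D-split C⊑R)))))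
          (potential≥2 C (⊑-trans C⊑T T.within) z (cong₂ _*_ zT zR) y y∈ (cong₂ _*_ yT yR))
          (form-mono e C⊑T (λ _ → ≤-refl)) (dot-⊕ _ T Q) (D-⊕ T Q) }
    where
    module T = Tight tT
    module R = Tight tR
    C Q : Pt n
    C = T ⊓ R
    Q = R ∖ C
    C⊑T : C ⊑ T
    C⊑T = ⊓-⊑ˡ (⊑-trans R.within bV)
    C⊑R : C ⊑ R
    C⊑R = ⊓-⊑ʳ (⊑-trans T.within bV)
    ∪-≤ : ∀ {a b c} → a ≤ c → b ≤ c → c ≤ 1 → a + (b ∸ a * b) ≤ c
    ∪-≤ {zero} p q z≤n = q
    ∪-≤ {zero} p q (s≤s z≤n) = q
    ∪-≤ {suc a} {zero} (s≤s z≤n) q (s≤s z≤n) = s≤s z≤n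
    ∪-≤ {suc a} {suc b} (s≤s z≤n) (s≤s z≤n) (s≤s z≤n) = s≤s z≤n
    arith : ∀ {x y} wt wc wq dt dc dq bc bt → wt ≤ 2 + 2 * dt → wc + wq ≤ 2 + 2 * (dc + dq + 2 * bc) → 2 + 2 * dc ≤ wc → bc ≤ bt →
            x ≡ wt + wq → y ≡ dt + dq + 2 * bt → x ≤ 2 + 2 * y
    arith wt wc wq dt dc dq bc bt h₁ h₂ h₃ h₄ refl refl =
      lin 0 (h₁ ⊞ h₂ ⊞ h₃ ⊞ 4 ⊠ h₄) (solve (wt ∷ wc ∷ wq ∷ dt ∷ dc ∷ dq ∷ bc ∷ bt ∷ []))

  -- Discharging at single vertices

  th u q : Pt n
  th i = thinN (t i) (row i V)
  u i = u₂N (t i) (row i V)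
  q y = row y (th ⊓ V)

  private
    th-bit : Bit th
    th-bit i = thinN-bit (t i) (row i V)

    u-bit : Bit u
    u-bit i = u₂N-bit (t i) (row i V)

    u⇒U₂ : ∀ {i} → u i ≡ 1 → U₂ i
    u⇒U₂ {i} h with u₂N-1 (t i) (row i V) h
    ... | p , r = u₂ p r

    th⇒Thin : ∀ {i} → th i ≡ 1 → Thin i
    th⇒Thin {i} h with thinN-1 (t i) (row i V) h
    ... | p , r = thin p r

    thV⇒ : ∀ {i} → (th ⊓ V) i ≡ 1 → th i ≡ 1
    thV⇒ {i} = m*n≡1⇒m≡1 (th i) (V i)

    uV⊑V : (u ⊓ V) ⊑ V
    uV⊑V = ⊓-⊑ʳ u-bit

  q≤1 : ∀ {y} → V y ≡ 1 → U₂ y → q y ≤ 1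
  q≤1 {y} y∈ Uy with row≥1 {y} {V} bV (≤-trans (s≤s z≤n) (≤-reflexive (sym (U₂.degree Uy))))
  ... | v , v∈ , yv with neighbours₂ (U₂.degree Uy) v∈ yv
  ... | b , b∈ , yb , nbr = ≤-trans (≤-reflexive (nbr (th ⊓ V) thV⊑V)) (go (bit (⊑-trans thV⊑V bV v)) (bit (⊑-trans thV⊑V bV b)))
    where
    thV⊑V : (th ⊓ V) ⊑ V
    thV⊑V = ⊓-⊑ʳ th-bit
    go : (th ⊓ V) v ≡ 0 ⊎ (th ⊓ V) v ≡ 1 → (th ⊓ V) b ≡ 0 ⊎ (th ⊓ V) b ≡ 1 → (th ⊓ V) v + (th ⊓ V) b ≤ 1
    go (inj₁ p) _ = ≤-trans (+-mono-≤ (≤-reflexive p) (⊑-trans thV⊑V bV b)) ≤-refl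
    go _ (inj₁ p) = ≤-trans (+-mono-≤ (⊑-trans thV⊑V bV v) (≤-reflexive p)) ≤-refl
    go (inj₂ p) (inj₂ r) = ⊥-elim (thin-path-excluded path (Thin.degree Tv))
      where
      Tv : Thin v
      Tv = th⇒Thin (thV⇒ p)
      path : Path v y b
      path = record { v∈ = v∈ ; a∈ = y∈ ; b∈ = b∈ ; Ua = Uy ; tb = th⇒Thin (thV⇒ r) ; tv = Thin.type Tv ; va = yv ; ab = yb ; na = nbr }

  -- The discharging rule: x sends 1 to each neighbouring U-vertex y of degree 2,
  -- and 2 if the other neighbour of y is thin; thin vertices send nothing.
  pay : Fin n → Pt n
  pay x y = e x y * (u y * ((1 ∸ th x) * (1 + q y)))

  -- Splitting each edge between its ends gives a vertex the share w - 2 deg of ρ(V). Doubled and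
  -- negated, its initial charge is 4 deg - 2w, which is -2 for type U and degree 2. The negative
  -- term and the charge sent stand in `before`, the positive ones in `after`.
  out inn before after : Pt n
  out x = dot (pay x) V
  inn x = dot (λ i → pay i x) V
  before x = 2 * w (t x) + out x
  after x = 4 * row x V + inn x

  Ok : Pt n → Set
  Ok S = dot before S ≤ dot after S

  private
    pay≤2 : ∀ x y → V y ≡ 1 → pay x y ≤ 2 * (e x y * u y)
    pay≤2 x y y∈ with bit (u-bit y)
    ... | inj₁ h = ≤-trans (≤-reflexive (trans (cong (λ z → e x y * (z * ((1 ∸ th x) * (1 + q y)))) h) (*-zeroʳ (e x y)))) z≤n
    ... | inj₂ h = ≤-trans (*-monoʳ-≤ (e x y) (*-monoʳ-≤ (u y) (*-mono-≤ (m∸n≤m 1 (th x)) (s≤s (q≤1 y∈ (u⇒U₂ h))))))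
                           (≤-reflexive (regroup (e x y) (u y)))
      where
      regroup : ∀ a b → a * (b * (1 * 2)) ≡ 2 * (a * b)
      regroup a b = solve (a ∷ b ∷ [])

    out≤2 : ∀ x → out x ≤ 2 * row x (u ⊓ V)
    out≤2 x = ≤-trans (dot-≤ bV (pay≤2 x)) (≤-reflexive (trans (dot-scale 2 (e x ⊓ u) V) (cong (2 *_) (dot-⊓ (e x) u V))))

    out≤1 : ∀ x → (∀ y → V y ≡ 1 → e x y ≡ 1 → u y ≡ 1 → q y ≡ 0) → out x ≤ row x (u ⊓ V)
    out≤1 x h = ≤-trans (dot-≤ {g = e x ⊓ u} bV λ y y∈ → go y y∈ (bit (e-bit x y)) (bit (u-bit y))) (≤-reflexive (dot-⊓ (e x) u V))
      where
      go : ∀ y → V y ≡ 1 → e x y ≡ 0 ⊎ e x y ≡ 1 → u y ≡ 0 ⊎ u y ≡ 1 → pay x y ≤ e x y * u y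
      go y y∈ (inj₁ p) _ = ≤-trans (≤-reflexive (cong (_* (u y * ((1 ∸ th x) * (1 + q y)))) p)) z≤n
      go y y∈ _ (inj₁ r) = ≤-trans (≤-reflexive (trans (cong (λ z → e x y * (z * ((1 ∸ th x) * (1 + q y)))) r) (*-zeroʳ (e x y)))) z≤n
      go y y∈ (inj₂ p) (inj₂ r) = *-monoʳ-≤ (e x y) (≤-trans (*-monoʳ-≤ (u y) (*-mono-≤ (m∸n≤m 1 (th x)) (≤-reflexive (cong suc (h y y∈ p r))))) (≤-reflexive (*-identityʳ (u y))))

    out-thin : ∀ {x} → th x ≡ 1 → out x ≡ 0
    out-thin {x} h = dot-zeroˡ bV λ y _ → trans (cong (λ z → e x y * (u y * ((1 ∸ z) * (1 + q y)))) h)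
      (trans (cong (e x y *_) (*-zeroʳ (u y))) (*-zeroʳ (e x y)))

    -- With q thin neighbours, the 2 - q others send 1 + q each: two payments of 1 or one payment of
    -- 2.
    inn-U₂ : ∀ {x} → V x ≡ 1 → u x ≡ 1 → 2 ≤ inn x
    inn-U₂ {x} x∈ h = ≤-trans (share (q≤1 x∈ (u⇒U₂ h)) (trans deg (U₂.degree (u⇒U₂ h)))) (≤-reflexive (sym inn≡))
      where
      fat : Pt n
      fat i = 1 ∸ th i
      inn≡ : inn x ≡ (1 + q x) * dot (e x ⊓ fat) V
      inn≡ = trans (dot-cong (λ i → trans (cong₂ (λ a b → a * (b * (fat i * (1 + q x)))) (e-sym i x) h) (regroup (e x i) (fat i) (q x))) (λ _ → refl))
                   (dot-scale (1 + q x) (e x ⊓ fat) V)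
        where
        regroup : ∀ a b c → a * (1 * (b * (1 + c))) ≡ (1 + c) * (a * b)
        regroup a b c = solve (a ∷ b ∷ c ∷ [])
      deg : q x + dot (e x ⊓ fat) V ≡ row x V
      deg = trans (cong (_+ dot (e x ⊓ fat) V) (sym (dot-⊓ (e x) th V))) (trans (sym (dot-⊕ˡ (e x ⊓ th) (e x ⊓ fat) V))
        (dot-cong (λ i → trans (sym (*-distribˡ-+ (e x i) (th i) (fat i))) (trans (cong (e x i *_) (m+[n∸m]≡n (th-bit i))) (*-identityʳ (e x i)))) (λ _ → refl)))
      share : ∀ {a b} → a ≤ 1 → a + b ≡ 2 → 2 ≤ (1 + a) * b
      share z≤n refl = ≤-refl
      share (s≤s z≤n) refl = ≤-refl

    star-bound : ∀ {x} → V x ≡ 1 → t x ≡ U → 3 ≤ row x V → row x (u ⊓ V) + 1 ≤ row x V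
    star-bound {x} x∈ tx deg = go (1 ≤? row x (V ∖ (u ⊓ V)))
      where
      go : Dec (1 ≤ row x (V ∖ (u ⊓ V))) → row x (u ⊓ V) + 1 ≤ row x V
      go (yes h) = ≤-trans (+-monoʳ-≤ _ h) (≤-reflexive (sym (dot-split (e x) uV⊑V)))
      go (no h) = ⊥-elim (star-excluded x∈ tx deg λ j j∈ xj → nbr j j∈ xj (bit (u-bit j)))
        where
        nbr : ∀ j → V j ≡ 1 → e x j ≡ 1 → u j ≡ 0 ⊎ u j ≡ 1 → t j ≡ U × row j V ≡ 2
        nbr j j∈ xj (inj₂ p) = U₂.type (u⇒U₂ p) , U₂.degree (u⇒U₂ p)
        nbr j j∈ xj (inj₁ p) = 1≢0 xj (row≡0 (n<1⇒n≡0 (≰⇒> h)) (∈-∖⁺ {X = V} {u ⊓ V} j∈ (cong (_* V j) p)))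

  -- Here `y` is a neighbour to which `x` sends 2; the other degree 3 vertices of this kind send at
  -- most 1 along each edge.
  record Bad (x : Fin n) : Set where
    field
      type   : t x ≢ N
      degree : row x V ≡ 3
      y      : Fin n
      y∈     : V y ≡ 1
      xy     : e x y ≡ 1
      Uy     : U₂ y
      q≥1    : 1 ≤ q y

  -- Let d be the degree. Type N can send 2 along every edge since 4d - 4 ≥ 2d; so can F for d ≥ 4,
  -- as 4d - 8 ≥ 2d. For U and d ≥ 4, `star-bound` spares one neighbour and 4d - 10 ≥ 2(d - 1). At d
  -- = 3 the charge 4 of F or 2 of U covers payments of 1 only. At d = 2 the types U and F send
  -- nothing.
  local : ∀ {x} → V x ≡ 1 → before x ≤ after x ⊎ Bad x
  local {x} x∈ = go (t x) (row x V) refl refl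
    where
    U≢N : U ≢ N
    U≢N ()
    F≢N : F ≢ N
    F≢N ()
    ru≤ : row x (u ⊓ V) ≤ row x V
    ru≤ = row-mono x uV⊑V

    arithN : ∀ {k} o r d i → o ≤ 2 * r → r ≤ d → 2 ≤ d → k ≡ 2 → 2 * k + o ≤ 4 * d + i
    arithN o r d i h₁ h₂ h₃ refl = lin i (h₁ ⊞ 2 ⊠ h₂ ⊞ 2 ⊠ h₃) (solve (o ∷ r ∷ d ∷ i ∷ []))
    arithU₂ : ∀ {k o d} i → o ≡ 0 → d ≡ 2 → 2 ≤ i → k ≡ 5 → 2 * k + o ≤ 4 * d + i
    arithU₂ i refl refl h refl = lin 0 h (solve (i ∷ []))
    arithF₂ : ∀ {k o d} i → o ≡ 0 → d ≡ 2 → k ≡ 4 → 2 * k + o ≤ 4 * d + i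
    arithF₂ i refl refl refl = m≤m+n 8 i
    arithU₃ : ∀ {k d} o r i → o ≤ r → r + 1 ≤ d → d ≡ 3 → k ≡ 5 → 2 * k + o ≤ 4 * d + i
    arithU₃ o r i h₁ h₂ refl refl = lin i (h₁ ⊞ h₂) (solve (o ∷ r ∷ i ∷ []))
    arithF₃ : ∀ {k d} o r i → o ≤ r → r ≤ d → d ≡ 3 → k ≡ 4 → 2 * k + o ≤ 4 * d + i
    arithF₃ o r i h₁ h₂ refl refl = lin (1 + i) (h₁ ⊞ h₂) (solve (o ∷ r ∷ i ∷ []))
    arithU₄ : ∀ {k} o r d i → o ≤ 2 * r → r + 1 ≤ d → 4 ≤ d → k ≡ 5 → 2 * k + o ≤ 4 * d + i
    arithU₄ o r d i h₁ h₂ h₃ refl = lin i (h₁ ⊞ 2 ⊠ h₂ ⊞ 2 ⊠ h₃) (solve (o ∷ r ∷ d ∷ i ∷ []))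
    arithF₄ : ∀ {k} o r d i → o ≤ 2 * r → r ≤ d → 4 ≤ d → k ≡ 4 → 2 * k + o ≤ 4 * d + i
    arithF₄ o r d i h₁ h₂ h₃ refl = lin i (h₁ ⊞ 2 ⊠ h₂ ⊞ 2 ⊠ h₃) (solve (o ∷ r ∷ d ∷ i ∷ []))

    three : t x ≢ N → row x V ≡ 3 → (out x ≤ row x (u ⊓ V) → before x ≤ after x) → before x ≤ after x ⊎ Bad x
    three tx d h with any? (λ y → 1 ≤? V y * (e x y * (u y * q y)))
    ... | yes (y , p) = inj₂ record { type = tx ; degree = d ; y = y ; y∈ = one (bV y) p₁ ; xy = one (e-bit x y) p₂ ; Uy = u⇒U₂ (one (u-bit y) p₃) ; q≥1 = p₄ }
      where
      one : ∀ {k} → k ≤ 1 → 1 ≤ k → k ≡ 1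
      one = ≤-antisym
      left : ∀ a b → 1 ≤ a * b → 1 ≤ a
      left (suc a) b h = s≤s z≤n
      right : ∀ a b → 1 ≤ a * b → 1 ≤ b
      right a b h = left b a (≤-trans h (≤-reflexive (*-comm a b)))
      p₁ = left (V y) _ p
      p′ = right (V y) _ p
      p₂ = left (e x y) _ p′
      p″ = right (e x y) _ p′
      p₃ = left (u y) _ p″
      p₄ = right (u y) _ p″
    ... | no np = inj₁ (h (out≤1 x λ y y∈ xy uy → n<1⇒n≡0 (≰⇒> λ r → np (y , *-mono-≤ (≤-reflexive (sym y∈)) (*-mono-≤ (≤-reflexive (sym xy)) (*-mono-≤ (≤-reflexive (sym uy)) r))))))

    go : ∀ τ d → t x ≡ τ → row x V ≡ d → before x ≤ after x ⊎ Bad x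
    go N d p r = inj₁ (arithN (out x) (row x (u ⊓ V)) (row x V) (inn x) (out≤2 x) ru≤ (degree≥2 x∈) (cong w p))
    go τ 0 p r = ⊥-elim (1+n≰n (≤-trans (degree≥2 x∈) (≤-trans (≤-reflexive r) z≤n)))
    go τ 1 p r = ⊥-elim (1+n≰n (≤-trans (degree≥2 x∈) (≤-reflexive r)))
    go U 2 p r = inj₁ (arithU₂ (inn x) (out-thin (cong₂ thinN p r)) r (inn-U₂ x∈ (cong₂ u₂N p r)) (cong w p))
    go F 2 p r = inj₁ (arithF₂ (inn x) (out-thin (cong₂ thinN p r)) r (cong w p))
    go U 3 p r = three (λ s → U≢N (trans (sym p) s)) r λ h →
      arithU₃ (out x) (row x (u ⊓ V)) (inn x) h (star-bound x∈ p (≤-reflexive (sym r))) r (cong w p)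
    go F 3 p r = three (λ s → F≢N (trans (sym p) s)) r λ h →
      arithF₃ (out x) (row x (u ⊓ V)) (inn x) h ru≤ r (cong w p)
    go U (suc (suc (suc (suc d)))) p r = inj₁ (arithU₄ (out x) (row x (u ⊓ V)) (row x V) (inn x) (out≤2 x)
      (star-bound x∈ p (≤-trans (m≤m+n 3 (suc d)) (≤-reflexive (sym r)))) (≤-trans (m≤m+n 4 d) (≤-reflexive (sym r))) (cong w p))
    go F (suc (suc (suc (suc d)))) p r = inj₁ (arithF₄ (out x) (row x (u ⊓ V)) (row x V) (inn x) (out≤2 x)
      ru≤ (≤-trans (m≤m+n 4 d) (≤-reflexive (sym r))) (cong w p))

  -- The thin neighbour of `y` is not `x`, which has degree 3; so it is the other neighbour `b`, and
  -- the path `x`, `y`, `b` yields the set.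
  bad-tight : ∀ {x} → V x ≡ 1 → (β : Bad x) → ¬ ¬ ∃ λ T → Tight T × T x ≡ 1 × T (Bad.y β) ≡ 0
  bad-tight {x} x∈ β with neighbours₂ (U₂.degree (Bad.Uy β)) x∈ (trans (e-sym (Bad.y β) x) (Bad.xy β))
  ... | b , b∈ , yb , nbr = path-tight path degree
    where
    open Bad β
    x-fat : (th ⊓ V) x ≡ 0
    x-fat = cong (_* V x) (trans (cong (thinN (t x)) degree) (thinN-3 (t x)))
    b-thin : th b ≡ 1
    b-thin = thV⇒ (≤-antisym (⊑-trans (⊓-⊑ʳ th-bit) bV b)
      (≤-trans q≥1 (≤-reflexive (trans (nbr (th ⊓ V) (⊓-⊑ʳ th-bit)) (cong (_+ (th ⊓ V) b) x-fat)))))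
    path : Path x y b
    path = record { v∈ = x∈ ; a∈ = y∈ ; b∈ = b∈ ; Ua = Uy ; tb = th⇒Thin b-thin ; tv = type ; va = trans (e-sym y x) xy ; ab = yb ; na = nbr }

  -- Charge of tight sets and their packing

  Ok-⊕ : ∀ {X Y} → Ok X → Ok Y → Ok (X ⊕ Y)
  Ok-⊕ {X} {Y} p r = ≤-trans (≤-reflexive (dot-⊕ before X Y)) (≤-trans (+-mono-≤ p r) (≤-reflexive (sym (dot-⊕ after X Y))))

  Ok-cong : ∀ {X Y} → (∀ i → X i ≡ Y i) → Ok X → Ok Y
  Ok-cong h p = ≤-trans (≤-reflexive (sym (dot-congʳ before h))) (≤-trans p (≤-reflexive (dot-congʳ after h)))

  private
    before-sum : ∀ S → dot before S ≡ 2 * W t S + form pay S V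
    before-sum S = trans (dot-⊕ˡ (λ i → 2 * w (t i)) out S) (cong (_+ form pay S V) (dot-scale 2 _ S))

    after-sum : ∀ S → dot after S ≡ 4 * B S V + form pay V S
    after-sum S = trans (dot-⊕ˡ (λ i → 4 * row i V) inn S) (cong₂ _+_ (dot-scale 4 (λ i → row i V) S) (sym (dot-swap pay V S)))

    pay-bound : ∀ {X Y} → X ⊑ V → Y ⊑ V → form pay X Y ≤ 2 * B X Y
    pay-bound {X} {Y} X⊑ Y⊑ = ≤-trans (dot-mono {g = λ i → 2 * row i Y} (λ i → ≤-trans
        (dot-≤ {g = λ j → 2 * e i j} (⊑-trans Y⊑ bV) λ j j∈ → ≤-trans (pay≤2 i j (⊑1 Y⊑ bV j∈)) (*-monoʳ-≤ 2 (≤-trans (*-monoʳ-≤ (e i j) (u-bit j)) (≤-reflexive (*-identityʳ (e i j))))))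
        (≤-reflexive (dot-scale 2 (e i) Y))) (λ _ → ≤-refl)) (≤-reflexive (dot-scale 2 (λ i → row i Y) X))

  -- Payments inside `T` cancel, and twice its potential is at most 4. Each outgoing edge
  -- contributes 4 on the side of `T`, of which at most 2 is sent out; two such edges leave the
  -- missing 4.
  tight-Ok : ∀ {T} → Tight T → Ok T
  tight-Ok {T} tT = ≤-trans (≤-reflexive (before-sum T)) (≤-trans
      (arith (W t T) (D T) (B T R) (form pay T T) (form pay T R) (form pay R T)
        (trans (form-cong pay (λ _ → refl) V≗) (form-⊕ʳ pay T T R)) (trans (form-cong e (λ _ → refl) V≗) (form-⊕ʳ e T T R))
        (trans (form-cong pay V≗ (λ _ → refl)) (form-⊕ˡ pay T R T))
        tight (two-edges within (proj₂ some) (proj₁ (proj₂ miss)) (proj₂ (proj₂ miss))) (pay-bound within (∖-⊑ V T)))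
      (≤-reflexive (sym (after-sum T))))
    where
    open Tight tT
    R : Pt n
    R = V ∖ T
    V≗ : ∀ i → V i ≡ (T ⊕ R) i
    V≗ = split within
    arith : ∀ {x y z} wt d b p r s → x ≡ p + r → y ≡ d + b → z ≡ p + s → wt ≤ 2 + 2 * d → 2 ≤ b → r ≤ 2 * b → 2 * wt + x ≤ 4 * y + z
    arith wt d b p r s refl refl refl h₁ h₂ h₃ = lin s (2 ⊠ h₁ ⊞ 2 ⊠ h₂ ⊞ h₃) (solve (wt ∷ d ∷ b ∷ p ∷ r ∷ s ∷ []))

  -- X being 0/1-valued, the tight sets in the union are disjoint.
  data Packed (X : Pt n) : Set where
    none : (∀ i → X i ≡ 0) → Packed X
    add  : ∀ {Y T} → Packed Y → Tight T → Bit X → (∀ i → X i ≡ Y i + T i) → Packed X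

  packed-⊑ : ∀ {X} → Packed X → X ⊑ V
  packed-⊑ (none h) i = ≤-trans (≤-reflexive (h i)) z≤n
  packed-⊑ {X} (add {Y} {T} p tT b h) i = ≤-trans (≤-reflexive (h i)) (join (packed-⊑ p i) (Tight.within tT i) (≤-trans (≤-reflexive (sym (h i))) (b i)))
    where
    join : ∀ {a b c} → a ≤ c → b ≤ c → a + b ≤ 1 → a + b ≤ c
    join {zero} p q r = q
    join {suc a} p q (s≤s r) with m+n≡0⇒n≡0 a (n≤0⇒n≡0 r)
    ... | refl = ≤-trans (≤-reflexive (cong suc (+-identityʳ a))) p

  packed-Ok : ∀ {X} → Packed X → Ok X
  packed-Ok (none h) = ≤-trans (≤-reflexive (trans (dot-congʳ before h) (dot-∅ before))) z≤n
  packed-Ok (add p tT b h) = Ok-cong (λ i → sym (h i)) (Ok-⊕ (packed-Ok p) (tight-Ok tT))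

  private
    ∪-disjoint : ∀ {y s r} → y + s ≤ 1 → r ≤ 1 → s * r ≡ 0 → (y + s) + (r ∸ (y + s) * r) ≡ (y + (r ∸ y * r)) + s
    ∪-disjoint {zero} {zero} p q h = sym (+-identityʳ _)
    ∪-disjoint {zero} {suc s} {zero} (s≤s z≤n) q h = refl
    ∪-disjoint {zero} {suc s} {suc r} (s≤s z≤n) q ()
    ∪-disjoint {suc y} {zero} {r} p q h = trans (cong (λ z → z + (r ∸ z * r)) (+-identityʳ (suc y))) (sym (+-identityʳ _))
    ∪-disjoint {suc zero} {suc s} (s≤s ()) q h
    ∪-disjoint {suc (suc y)} {suc s} (s≤s ()) q h

    ∪-assoc : ∀ {y s r} → y + s ≤ 1 → r ≤ 1 → (y + s) + (r ∸ (y + s) * r) ≡ y + ((s + (r ∸ s * r)) ∸ y * (s + (r ∸ s * r)))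
    ∪-assoc {zero} p q = refl
    ∪-assoc {suc zero} {zero} {zero} p q = refl
    ∪-assoc {suc zero} {zero} {suc r} p (s≤s z≤n) = refl
    ∪-assoc {suc zero} {suc s} (s≤s ()) q
    ∪-assoc {suc (suc y)} (s≤s ()) q

    ∪-≤1 : ∀ {x r} → x ≤ 1 → r ≤ 1 → x + (r ∸ x * r) ≤ 1
    ∪-≤1 z≤n q = q
    ∪-≤1 {r = zero} (s≤s z≤n) q = s≤s z≤n
    ∪-≤1 {r = suc r} (s≤s z≤n) (s≤s z≤n) = s≤s z≤n

  -- Packed sets meeting `T` are merged into it, the others are kept. Merging needs a vertex outside
  -- both: `S` misses `x` because `X` does, hence misses `y` by `tight-avoids`. That `T` contains
  -- `x` and misses `y` carries over to the union.
  absorb : ∀ {X T x y} → Packed X → Tight T → U₂ y → V x ≡ 1 → V y ≡ 1 → e y x ≡ 1 → T x ≡ 1 → T y ≡ 0 → X x ≡ 0 →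
           Packed (X ∪ T)
  absorb {X} {T} (none h) tT Uy x∈ y∈ yx xT yT xX = add {Y = ∅} (none λ _ → refl) tT
    (λ i → ∪-≤1 (≤-trans (≤-reflexive (h i)) z≤n) (⊑-trans (Tight.within tT) bV i))
    (λ i → cong (λ z → z + (T i ∸ z * T i)) (h i))
  absorb {X} {T} {x} {y} (add {Y} {S} p tS b h) tT Uy x∈ y∈ yx xT yT xX = go (Empty? (⊑-trans (⊓-⊑ˡ {X = S} bT) bS))
    where
    bT : Bit T
    bT = ⊑-trans (Tight.within tT) bV
    bS : Bit S
    bS = ⊑-trans (Tight.within tS) bV
    y+s≤1 : ∀ i → Y i + S i ≤ 1
    y+s≤1 i = ≤-trans (≤-reflexive (sym (h i))) (b i)
    ∪≤1 : Bit (X ∪ T)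
    ∪≤1 i = ∪-≤1 (b i) (bT i)
    xY : Y x ≡ 0
    xY = m+n≡0⇒m≡0 (Y x) (trans (sym (h x)) xX)
    xS : S x ≡ 0
    xS = m+n≡0⇒n≡0 (Y x) (trans (sym (h x)) xX)
    X∪ : ∀ i → (X ∪ T) i ≡ (Y i + S i) + (T i ∸ (Y i + S i) * T i)
    X∪ i = cong (λ z → z + (T i ∸ z * T i)) (h i)
    go : (∀ i → (S ⊓ T) i ≡ 0) ⊎ (∃ λ z → (S ⊓ T) z ≡ 1) → Packed (X ∪ T)
    go (inj₁ d) = add (absorb p tT Uy x∈ y∈ yx xT yT xY) tS ∪≤1 λ i → trans (X∪ i) (∪-disjoint {Y i} (y+s≤1 i) (bT i) (d i))
    go (inj₂ (z , d)) = packed-cong (λ i → trans (X∪ i) (∪-assoc {Y i} (y+s≤1 i) (bT i)))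
        (absorb p (tight-∪ tS tT zS zT y∈ yS yT) Uy x∈ y∈ yx (cong₂ _+_ xS (trans (cong (λ k → T x ∸ k * T x) xS) xT)) (cong₂ _+_ yS (trans (cong (λ k → T y ∸ k * T y) yS) yT)) xY)
      where
      zS : S z ≡ 1
      zS = m*n≡1⇒m≡1 (S z) (T z) d
      zT : T z ≡ 1
      zT = m*n≡1⇒n≡1 (S z) (T z) d
      yS : S y ≡ 0
      yS = tight-avoids tS Uy y∈ x∈ yx xS
      packed-cong : ∀ {P Q} → (∀ i → P i ≡ Q i) → Packed Q → Packed P
      packed-cong h (none k) = none λ i → trans (h i) (k i)
      packed-cong h (add p tT b k) = add p tT (λ i → ≤-trans (≤-reflexive (h i)) (b i)) λ i → trans (h i) (k i)

  Done : Pt n → Fin n → Set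
  Done X x = V x ≡ 1 → before x ≤ after x ⊎ X x ≡ 1

  -- Absorbing a set never removes a vertex from the union, so vertices already dealt with stay so.
  -- The double negation is inherited from `bad-tight`.
  cover : ∀ xs → ¬ ¬ ∃ λ X → Packed X × All (Done X) xs
  cover [] k = k (∅ , none (λ _ → refl) , All.[])
  cover (x ∷ xs) k = cover xs λ { (X , p , ds) → extend X p ds (bit (bV x)) (bit (⊑-trans (packed-⊑ p) bV x)) }
    where
    extend : ∀ X → Packed X → All (Done X) xs → V x ≡ 0 ⊎ V x ≡ 1 → X x ≡ 0 ⊎ X x ≡ 1 → ⊥
    extend X p ds (inj₁ x∉) _ = k (X , p , (λ x∈ → 1≢0 x∈ x∉) All.∷ ds)
    extend X p ds _ (inj₂ xX) = k (X , p , (λ _ → inj₂ xX) All.∷ ds)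
    extend X p ds (inj₂ x∈) (inj₁ xX) = split-bad (local x∈)
      where
      split-bad : before x ≤ after x ⊎ Bad x → ⊥
      split-bad (inj₁ ok) = k (X , p , (λ _ → inj₁ ok) All.∷ ds)
      split-bad (inj₂ β) = bad-tight x∈ β λ { (T , tT , xT , yT) →
          k (X ∪ T , absorb p tT Uy x∈ y∈ (trans (e-sym y x) xy) xT yT xX , (λ _ → inj₂ (cong₂ _+_ xX (trans (cong (λ z → T x ∸ z * T x) xX) xT)))
            All.∷ All.map (λ d z∈ → map₂ (grow T (⊑-trans (Tight.within tT) bV)) (d z∈)) ds) }
        where
        open Bad β
        grow : ∀ T → Bit T → ∀ {z} → X z ≡ 1 → (X ∪ T) z ≡ 1
        grow T bT {z} h = ≤-antisym (∪-≤1 (≤-reflexive h) (bT z)) (≤-trans (≤-reflexive (sym h)) (m≤m+n (X z) _))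

  no-counterexample : ∀ {x} → V x ≡ 1 → ⊥
  no-counterexample {x} x∈ = cover (allFin n) λ { (X , p , ds) → overcharged (Ok-cong (λ i → sym (split (packed-⊑ p) i))
      (Ok-⊕ (packed-Ok p) (dot-≤ (⊑-trans (∖-⊑ V X) bV) λ i i∈ → outside X ds i (∈-∖ {Y = X} bV i∈)))) }
    where
    outside : ∀ X → All (Done X) (allFin n) → ∀ i → V i ≡ 1 × X i ≡ 0 → before i ≤ after i
    outside X ds i (i∈ , i∉) = [ (λ h → h) , (λ h → 1≢0 h i∉) ]′ (All.lookup ds (∈-allFin i) i∈)
    overcharged : ¬ Ok V
    overcharged ok = contra (W t V) (D V) (form pay V V)
        (≤-trans (≤-reflexive (sym (before-sum V))) (≤-trans ok (≤-reflexive (after-sum V)))) (good V (λ _ → ≤-refl) x x∈)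
      where
      contra : ∀ a d p → 2 * a + p ≤ 4 * d + p → 1 + 2 * d ≤ a → ⊥
      contra a d p h₁ h₂ = absurd-lin 1 (h₁ ⊞ 2 ⊠ h₂) (solve (a ∷ d ∷ p ∷ []))

colourable : ∀ {n} (G : Adj n) {V : Pt n} (t : Fin n → Ty) → Bit V → Net.Good G V t → ¬ ¬ Net.Col G V t
colourable {n} G t bV = bounded _ G t bV ≤-refl
  where
  bounded : ∀ k (G : Adj n) {V : Pt n} (t : Fin n → Ty) → Bit V → size V ≤ k → Net.Good G V t → ¬ ¬ Net.Col G V t
  bounded k G {V} t bV h good ¬col with Empty? bV
  ... | inj₁ ∄ = ¬col record
      { I = ∅ ; I⊑V = λ _ → z≤n ; I-U = λ _ () ; indep = λ _ () ; sparse = λ x p → 1≢0 p (∄ x) ; avoid = λ x p → 1≢0 p (∄ x)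
      ; forest = λ S S⊑ s s∈ → 1≢0 s∈ (⊑0 S⊑ (∄ s)) }
  bounded zero G {V} t bV h good ¬col | inj₂ (x , x∈) = 1+n≰n (≤-trans (size≥1 {X = V} x∈) h)
  bounded (suc k) G {V} t bV h good ¬col | inj₂ (x , x∈) =
    Minimal.no-counterexample G bV t good (λ G′ V′ t′ b′ s → bounded k G′ t′ b′ (≤-pred (≤-trans s h))) ¬col x∈

-- Colouring a forest by depth modulo 3

rot : Fin 3 → Fin 3
rot zero = suc zero
rot (suc zero) = suc (suc zero)
rot (suc (suc zero)) = zero

rot≢ : ∀ k → rot k ≢ k
rot≢ zero ()
rot≢ (suc zero) ()
rot≢ (suc (suc zero)) ()

rot²≢ : ∀ k → rot (rot k) ≢ k
rot²≢ zero ()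
rot²≢ (suc zero) ()
rot²≢ (suc (suc zero)) ()

-- Two different colours out of three are consecutive in cyclic order; so the colours alone tell
-- which end of a forest edge is the parent.
rot-cases : ∀ j k → j ≢ k → rot j ≡ k ⊎ rot k ≡ j
rot-cases zero zero h = ⊥-elim (h refl)
rot-cases zero (suc zero) h = inj₁ refl
rot-cases zero (suc (suc zero)) h = inj₂ refl
rot-cases (suc zero) zero h = inj₂ refl
rot-cases (suc zero) (suc zero) h = ⊥-elim (h refl)
rot-cases (suc zero) (suc (suc zero)) h = inj₁ refl
rot-cases (suc (suc zero)) zero h = inj₁ refl
rot-cases (suc (suc zero)) (suc zero) h = inj₂ refl
rot-cases (suc (suc zero)) (suc (suc zero)) h = ⊥-elim (h refl)

module Depth {n} (G : Adj n) where
  open Net G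

  unique-neighbour : ∀ {x y z X} → row x X ≤ 1 → X y ≡ 1 → X z ≡ 1 → e x y ≡ 1 → e x z ≡ 1 → y ≡ z
  unique-neighbour {x} {y} {z} {X} r y∈ z∈ xy xz with y ≟ z
  ... | yes h = h
  ... | no h = ⊥-elim (1+n≰n (≤-trans (≤-trans (≤-reflexive (sym two)) (row-mono x pair)) r))
    where
    two : row x (δ y ⊕ δ z) ≡ 2
    two = trans (row-⊕ x (δ y) (δ z)) (cong₂ _+_ (trans (row-δ x y) xy) (trans (row-δ x z) xz))
    pair : δ y ⊕ δ z ⊑ X
    pair i with y ≟ i
    ... | yes refl = ≤-reflexive (trans (cong₂ _+_ (δ-self y) (δ-other λ p → h (sym p))) (sym y∈))
    ... | no ne = ≤-trans (≤-reflexive (cong (_+ δ z i) (δ-other ne))) (δ-⊑ z∈ i)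

  -- A parent is a neighbour whose colour comes just before. Depth itself is not stored: colours
  -- modulo 3 with at most one parent per vertex carry all that is used later.
  record Rooted (X : Pt n) (c : Fin n → Fin 3) : Set where
    field
      proper : ∀ x y → X x ≡ 1 → X y ≡ 1 → e x y ≡ 1 → c x ≢ c y
      parent : ∀ x y z → X x ≡ 1 → X y ≡ 1 → X z ≡ 1 → e x y ≡ 1 → e x z ≡ 1 → rot (c y) ≡ c x → rot (c z) ≡ c x → y ≡ z

  -- Otherwise all degrees in `X` are at least 2, and their sum `D X` is too large for a forest.
  leaf : ∀ {X x} → Bit X → Forest X → X x ≡ 1 → ∃ λ l → X l ≡ 1 × row l X ≤ 1
  leaf {X} {x} b f x∈ with any? (λ l → (X l ≟ᴺ 1) ×-dec (row l X ≤? 1))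
  ... | yes h = h
  ... | no h = ⊥-elim (contra (D X) (size X) (f X (λ _ → ≤-refl) x x∈) (≤-trans (≤-reflexive (sym (dot-scale 2 full X))) (dot-≤ b λ i i∈ → ≰⇒> λ r → h (i , i∈ , r))))
    where
    contra : ∀ d s → d + 2 ≤ 2 * s → 2 * s ≤ d → ⊥
    contra d s h₁ h₂ = absurd-lin 1 (h₁ ⊞ h₂) (solve (d ∷ s ∷ []))

  opaque
    recolour : (Fin n → Fin 3) → Fin n → Fin 3 → Fin n → Fin 3
    recolour c x k y with x ≟ y
    ... | yes _ = k
    ... | no _ = c y

    recolour-self : ∀ c x k → recolour c x k x ≡ k
    recolour-self c x k with x ≟ x
    ... | yes _ = refl
    ... | no h = ⊥-elim (h refl)

    recolour-other : ∀ c {x} k {y} → x ≢ y → recolour c x k y ≡ c y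
    recolour-other c {x} k {y} h with x ≟ y
    ... | yes p = ⊥-elim (h p)
    ... | no _ = refl

  -- The colour `k` makes `l` a child of its neighbour, if there is one. By `rot²≢` that neighbour
  -- does not become a child of `l` at the same time, as it would modulo 2.
  rooted-leaf : ∀ {X l c k} → Bit X → row l X ≤ 1 → X l ≡ 1 → Rooted (X ∖ δ l) c →
                (∀ y → X y ≡ 1 → e l y ≡ 1 → k ≡ rot (c y)) → Rooted X (recolour c l k)
  rooted-leaf {X} {l} {c} {k} b r l∈ ρ hk = record { proper = proper′ ; parent = parent′ }
    where
    open Rooted ρ
    c′ = recolour c l k
    c′l : c′ l ≡ k
    c′l = recolour-self c l k
    keep : ∀ {y} → l ≢ y → c′ y ≡ c y
    keep = recolour-other c k
    rest : ∀ {y} → l ≢ y → X y ≡ 1 → (X ∖ δ l) y ≡ 1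
    rest ne y∈ = ∈-∖⁺ {X = X} {δ l} y∈ (δ-other ne)
    loop : ∀ {y} → e l y ≡ 1 → l ≢ y
    loop h refl = 1≢0 h (e-irr l)
    below : ∀ y → X y ≡ 1 → e l y ≡ 1 → c′ l ≡ rot (c′ y)
    below y y∈ ly = trans c′l (trans (hk y y∈ ly) (cong rot (sym (keep (loop ly)))))
    flip : ∀ {x} → e x l ≡ 1 → e l x ≡ 1
    flip {x} h = trans (e-sym l x) h
    proper′ : ∀ x y → X x ≡ 1 → X y ≡ 1 → e x y ≡ 1 → c′ x ≢ c′ y
    proper′ x y x∈ y∈ xy h with l ≟ x | l ≟ y
    ... | yes refl | _ = rot≢ (c′ y) (trans (sym (below y y∈ xy)) h)
    ... | no _ | yes refl = rot≢ (c′ x) (trans (sym (below x x∈ (flip xy))) (sym h))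
    ... | no p | no q = proper x y (rest p x∈) (rest q y∈) xy (trans (sym (keep p)) (trans h (keep q)))
    child : ∀ {x} → X x ≡ 1 → e x l ≡ 1 → rot (c′ l) ≢ c′ x
    child {x} x∈ xl h = rot²≢ (c′ x) (trans (cong rot (sym (below x x∈ (flip xl)))) h)
    parent′ : ∀ x y z → X x ≡ 1 → X y ≡ 1 → X z ≡ 1 → e x y ≡ 1 → e x z ≡ 1 → rot (c′ y) ≡ c′ x → rot (c′ z) ≡ c′ x → y ≡ z
    parent′ x y z x∈ y∈ z∈ xy xz hy hz with l ≟ x | l ≟ y | l ≟ z
    ... | yes refl | _ | _ = unique-neighbour r y∈ z∈ xy xz
    ... | no _ | yes refl | _ = ⊥-elim (child x∈ xy hy)
    ... | no _ | no _ | yes refl = ⊥-elim (child x∈ xz hz)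
    ... | no p | no q | no s = parent x y z (rest p x∈) (rest q y∈) (rest s z∈) xy xz
          (trans (cong rot (sym (keep q))) (trans hy (keep p))) (trans (cong rot (sym (keep s))) (trans hz (keep p)))

  forest-colouring : ∀ {X} → Bit X → Forest X → ∃ (Rooted X)
  forest-colouring bX = go _ bX ≤-refl
    where
    go : ∀ k {X} → Bit X → size X ≤ k → Forest X → ∃ (Rooted X)
    go k {X} b h f with Empty? b
    ... | inj₁ ∄ = (λ _ → zero) , record { proper = λ x _ p → 1≢0 p (∄ x) ; parent = λ x _ _ p → 1≢0 p (∄ x) }
    go zero {X} b h f | inj₂ (x , x∈) = ⊥-elim (1+n≰n (≤-trans (size≥1 {X = X} x∈) h))
    go (suc k) {X} b h f | inj₂ (x , x∈) with leaf b f x∈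
    ... | l , l∈ , r with go k {X ∖ δ l} (⊑-trans (∖-⊑ X (δ l)) b)
                           (≤-pred (≤-trans (≤-reflexive (trans (cong (_+ size (X ∖ δ l)) (sym (size-δ l))) (sym (dot-split full (δ-⊑ l∈))))) h))
                           (Forest-mono (∖-⊑ X (δ l)) f)
    ... | c , ρ with 1 ≤? row l X
    ...   | no q = recolour c l zero , rooted-leaf b r l∈ ρ λ y y∈ ly → 1≢0 ly (row≡0 (n<1⇒n≡0 (≰⇒> q)) y∈)
    ...   | yes q with row≥1 b q
    ...     | p , p∈ , lp = recolour c l (rot (c p)) , rooted-leaf b r l∈ ρ λ y y∈ ly → cong (λ z → rot (c z)) (unique-neighbour r p∈ y∈ lp ly)

-- Star colourings

module StarColouring (G : Graph) where
  open Graph G using (irrefl) renaming (n to order; sym to adj-sym)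

  -- `NoP₄` forbids two-coloured paths on four vertices; `p ≡ r` and `q ≡ s` are the walks that turn
  -- back. With quantifiers over finite sets only, it can be decided by search, without
  -- reachability.
  Proper NoP₄ Nice : ∀ {k} → (Fin order → Fin k) → Set
  Proper c = ∀ i j → adj G i j ≡ true → c i ≢ c j
  NoP₄ c = ∀ p q r s → adj G p q ≡ true → adj G q r ≡ true → adj G r s ≡ true → c p ≡ c r → c q ≡ c s → p ≡ r ⊎ q ≡ s
  Nice c = Proper c × NoP₄ c

  nice? : ∀ {k} (c : Fin order → Fin k) → Dec (Nice c)
  nice? c =
    all? (λ i → all? λ j → (adj G i j ≟ᴮ true) →-dec ¬? (c i ≟ c j)) ×-dec
    all? (λ p → all? λ q → all? λ r → all? λ s →
      (adj G p q ≟ᴮ true) →-dec ((adj G q r ≟ᴮ true) →-dec ((adj G r s ≟ᴮ true) →-dec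
      ((c p ≟ c r) →-dec ((c q ≟ c s) →-dec ((p ≟ r) ⊎-dec (q ≟ s)))))))

  nice-cong : ∀ {k} {c d : Fin order → Fin k} → (∀ i → d i ≡ c i) → Nice c → Nice d
  nice-cong h (pr , np) =
    (λ i j ij eq → pr i j ij (trans (sym (h i)) (trans eq (h j)))) ,
    (λ p q r s pq qr rs pr qs → np p q r s pq qr rs (trans (sym (h p)) (trans pr (h r))) (trans (sym (h q)) (trans qs (h s))))

  -- Functions into Fin k form a finite type, so a colouring that does not
  -- fail to exist can be found by search.
  nice-stable : ∀ {k} → ¬ ¬ ∃ (Nice {k}) → ∃ (Nice {k})
  nice-stable {k} h with any? {n = k ^ order} (λ i → nice? (finToFun i))
  ... | yes (i , p) = finToFun i , p
  ... | no np = ⊥-elim (h λ { (c , p) → np (funToFin c , nice-cong (finToFun-funToFin c) p) })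

  module _ {k} (c : Fin order → Fin k) (nice : Nice c) (a b : Fin k) where
    private
      proper = proj₁ nice
      noP₄ = proj₂ nice

      P : Fin order → Bool
      P = twoColoured c a b

      P⇒ : ∀ v → P v ≡ true → c v ≡ a ⊎ c v ≡ b
      P⇒ v h with c v ≟ a | c v ≟ b
      ... | yes p | _ = inj₁ p
      ... | no _ | yes q = inj₂ q

      same : ∀ {x y z} → P x ≡ true → P y ≡ true → P z ≡ true → adj G x y ≡ true → adj G y z ≡ true → c x ≡ c z
      same {x} {y} {z} px py pz xy yz with P⇒ x px | P⇒ y py | P⇒ z pz
      ... | inj₁ p | _ | inj₁ r = trans p (sym r)
      ... | inj₂ p | _ | inj₂ r = trans p (sym r)
      ... | inj₁ p | inj₁ q | inj₂ r = ⊥-elim (proper x y xy (trans p (sym q)))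
      ... | inj₁ p | inj₂ q | inj₂ r = ⊥-elim (proper y z yz (trans q (sym r)))
      ... | inj₂ p | inj₂ q | inj₁ r = ⊥-elim (proper x y xy (trans p (sym q)))
      ... | inj₂ p | inj₁ q | inj₁ r = ⊥-elim (proper y z yz (trans q (sym r)))

      flip : ∀ {x y} → adj G x y ≡ true → adj G y x ≡ true
      flip {x} {y} h = trans (adj-sym y x) h

      closed : ∀ {C : Fin order → Set} → (∀ x y → C x → adj G x y ≡ true → P y ≡ true → C y) → ∀ {x y} → C x → Reach G P x y → C y
      closed f cx here = cx
      closed f cx (step xy py r) = closed f (f _ _ cx xy py) r

      centred : ∀ {v z} → Reach G P v z → v ≡ z ⊎ (adj G z v ≡ true × P v ≡ true) →
                (∀ x y → adj G z x ≡ true → P x ≡ true → adj G x y ≡ true → P y ≡ true → y ≡ z) → P z ≡ true →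
                Σ (Fin order) λ z → Reach G P v z × (∀ x → Reach G P v x → x ≢ z → adj G z x ≡ true) ×
                  (∀ x y → Reach G P v x → Reach G P v y → adj G x y ≡ true → (x ≡ z) ⊎ (y ≡ z))
      centred {v} {z} vz cv leafy pz = z , vz , (λ x r ne → [ (λ h → ⊥-elim (ne h)) , proj₁ ]′ (component r)) , edges
        where
        C : Fin order → Set
        C x = x ≡ z ⊎ (adj G z x ≡ true × P x ≡ true)
        component : ∀ {x} → Reach G P v x → C x
        component = closed {C} (λ { x y (inj₁ refl) xy py → inj₂ (xy , py) ; x y (inj₂ (zx , px)) xy py → inj₁ (leafy x y zx px xy py) }) cv
        inP : ∀ {y} → C y → P y ≡ true
        inP (inj₁ refl) = pz
        inP (inj₂ (_ , py)) = py
        edges : ∀ x y → Reach G P v x → Reach G P v y → adj G x y ≡ true → (x ≡ z) ⊎ (y ≡ z)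
        edges x y rx ry xy with component rx
        ... | inj₁ h = inj₁ h
        ... | inj₂ (zx , px) = inj₂ (leafy x y zx px xy (inP (component ry)))

    -- The centre is a neighbour `u` of `v` that has a further neighbour `w` in the two colours; if
    -- there is none, `v` is a centre itself.
    star-forest : InducedStarForest G (twoColoured c a b)
    star-forest v pv with any? (λ u → any? λ w →
      (adj G v u ≟ᴮ true) ×-dec (P u ≟ᴮ true) ×-dec (adj G u w ≟ᴮ true) ×-dec (P w ≟ᴮ true) ×-dec ¬? (w ≟ v))
    ... | no h = centred here (inj₁ refl) leafy pv
      where
      leafy : ∀ x y → adj G v x ≡ true → P x ≡ true → adj G x y ≡ true → P y ≡ true → y ≡ v
      leafy x y vx px xy py with y ≟ v
      ... | yes q = q
      ... | no q = ⊥-elim (h (x , y , vx , px , xy , py , q))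
    ... | yes (u , w , vu , pu , uw , pw , w≢v) = centred (step vu pu here) (inj₂ (flip vu , pv)) leafy pu
      where
      leafy : ∀ x y → adj G u x ≡ true → P x ≡ true → adj G x y ≡ true → P y ≡ true → y ≡ u
      -- A neighbour `x` of `u` with a further neighbour `y` would end a two-coloured path on four
      -- vertices, begun at `w`, or at `v` when `x` is `w` itself.
      leafy x y ux px xy py with w ≟ x
      ... | no w≢x = [ (λ h → ⊥-elim (w≢x h)) , sym ]′ (noP₄ w u x y (flip uw) ux xy (same pw pu px (flip uw) ux) (same pu px py ux xy))
      ... | yes refl = [ (λ h → ⊥-elim (w≢v (sym h))) , sym ]′ (noP₄ v u x y vu ux xy (same pv pu px vu ux) (same pu px py ux xy))

  nice⇒star : ∀ {k} {c : Fin order → Fin k} → Nice c → IsStarColouring G k c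
  nice⇒star {c = c} h = proj₁ h , star-forest c h

-- Maximum average degree

toℕ₂ : Bool → ℕ
toℕ₂ b = if b then 1 else 0

toAdj : (G : Graph) → Adj (Graph.n G)
toAdj G = record
  { e = λ i j → toℕ₂ (adj G i j)
  ; e-bit = λ i j → toℕ₂-bit (adj G i j)
  ; e-sym = λ i j → cong toℕ₂ (Graph.sym G i j)
  ; e-irr = λ i → cong toℕ₂ (Graph.irrefl G i) }
  where
  toℕ₂-bit : ∀ b → toℕ₂ b ≤ 1
  toℕ₂-bit true = ≤-refl
  toℕ₂-bit false = z≤n

-- The summation in nE is local to its definition; unification solves sumF to it.
mutual
  sumF : (G : Graph) (H : Subgraph G) {m : ℕ} → (Fin m → ℕ) → ℕ
  sumF = _

  nE≡sumF : (G : Graph) (H : Subgraph G) → nE H ≡ sumF G H (λ i → count (λ j → (toℕ i <ᵇ toℕ j) ∧ Subgraph.es H i j))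
  nE≡sumF G H with Graph.n G | (λ (i : Fin (Graph.n G)) → count (λ j → (toℕ i <ᵇ toℕ j) ∧ Subgraph.es H i j))
  ... | _ | _ = refl

opaque
  unfolding dot

  count-size : (p : Fin n → Bool) → count p ≡ dot (λ i → toℕ₂ (p i)) full
  count-size {zero} p = refl
  count-size {suc n} p = cong₂ _+_ (sym (*-identityʳ _)) (count-size (λ i → p (suc i)))

  sumF-size : ∀ G H (f : Pt n) → sumF G H f ≡ dot f full
  sumF-size {zero} G H f = refl
  sumF-size {suc n} G H f = cong₂ _+_ (sym (*-identityʳ _)) (sumF-size G H (λ i → f (suc i)))

-- From the density bound to the potential, and from the partition to colours

module FromGraph (G : Graph) where
  open Net (toAdj G)
  open StarColouring G

  private
    order = Graph.n G

  module _ (S : Pt order) (bS : Bit S) where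
    private
      vs : Fin order → Bool
      vs i = 0 <ᵇ S i

      es : Fin order → Fin order → Bool
      es i j = adj G i j ∧ (vs i ∧ vs j)

      ∧-true : ∀ {a b} → a ∧ b ≡ true → a ≡ true × b ≡ true
      ∧-true {true} h = refl , h

      H : Subgraph G
      H = record { vs = vs ; es = es ; es-sub = λ i j h → proj₁ (∧-true h) , ∧-true (proj₂ (∧-true {adj G i j} h)) }

      -- `nE` counts an edge from its smaller end only. Adding the transpose gives a total of twice
      -- `nE`, which can be compared with `D` entry by entry.
      L M : Fin order → Pt order
      L i j = toℕ₂ ((toℕ i <ᵇ toℕ j) ∧ es i j)
      M i j = L i j + L j i

      vs-S : ∀ i → toℕ₂ (vs i) ≡ S i
      vs-S i with S i | bS i
      ... | .0 | z≤n = refl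
      ... | .1 | s≤s z≤n = refl

      nV≡ : nV H ≡ size S
      nV≡ = trans (count-size vs) (trans (dot-comm _ full) (dot-congʳ full vs-S))

      nE≡ : nE H ≡ form L full full
      nE≡ = trans (nE≡sumF G H) (trans (sumF-size G H _) (dot-cong (λ i → count-size _) (λ _ → refl)))

      M-sum : form M full full ≡ 2 * form L full full
      M-sum = trans (dot-cong (λ i → dot-⊕ˡ (L i) (λ j → L j i) full) (λ _ → refl))
        (trans (dot-⊕ˡ (λ i → dot (L i) full) (λ i → dot (λ j → L j i) full) full)
        (cong (form L full full +_) (trans (sym (dot-swap L full full)) (sym (+-identityʳ _)))))

      <ᵇ-true : ∀ {i j} → i < j → (i <ᵇ j) ≡ true
      <ᵇ-true {zero} (s≤s h) = refl
      <ᵇ-true {suc i} (s≤s h) = <ᵇ-true h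

      L-true : ∀ {i j} → toℕ i < toℕ j → adj G i j ≡ true → S i ≡ 1 → S j ≡ 1 → L i j ≡ 1
      L-true lt ij i∈ j∈ = cong toℕ₂ (cong₂ _∧_ (<ᵇ-true lt) (cong₂ _∧_ ij (cong₂ _∧_ (cong (0 <ᵇ_) i∈) (cong (0 <ᵇ_) j∈))))

      e≤M : ∀ i j → S i ≡ 1 → S j ≡ 1 → e i j ≤ M i j
      e≤M i j i∈ j∈ = go (adj G i j) refl
        where
        go : ∀ b → adj G i j ≡ b → toℕ₂ b ≤ M i j
        go false ij = z≤n
        go true ij with <-cmp (toℕ i) (toℕ j)
        ... | tri< lt _ _ = ≤-trans (≤-reflexive (sym (L-true lt ij i∈ j∈))) (m≤m+n (L i j) (L j i))
        ... | tri> _ _ gt = ≤-trans (≤-reflexive (sym (L-true gt (trans (Graph.sym G j i) ij) j∈ i∈))) (m≤n+m (L j i) (L i j))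
        ... | tri≈ _ eq _ = 1≢0 (cong toℕ₂ (trans (cong (adj G i) (toℕ-injective eq)) ij)) (cong toℕ₂ (Graph.irrefl G i))

    D≤2nE : D S ≤ 2 * nE H
    D≤2nE = ≤-trans (dot-≤ bS λ i i∈ → ≤-trans (dot-≤ bS λ j j∈ → e≤M i j i∈ j∈) (dot-monoʳ (M i) bS))
      (≤-trans (dot-monoʳ _ bS) (≤-reflexive (trans M-sum (cong (2 *_) (sym nE≡)))))

    mad⇒low : MadLessFiveHalves G → ∀ x → S x ≡ 1 → 1 + 2 * D S ≤ 5 * size S
    mad⇒low mad x x∈ = arith (nE H) (D S) (size S) (≤-trans (mad H (≤-trans (size≥1 {X = S} x∈) (≤-reflexive (sym nV≡)))) (≤-reflexive (cong (5 *_) nV≡))) D≤2nE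
      where
      arith : ∀ m d s → 1 + 4 * m ≤ 5 * s → d ≤ 2 * m → 1 + 2 * d ≤ 5 * s
      arith m d s h₁ h₂ = lin 0 (h₁ ⊞ 2 ⊠ h₂) (solve (m ∷ d ∷ s ∷ []))

  mad⇒good : MadLessFiveHalves G → Good full (λ _ → U)
  mad⇒good mad S bS x x∈ = ≤-trans (mad⇒low S bS mad x x∈) (≤-reflexive (sym (dot-scale 5 full S)))

  private
    paint : ℕ → Fin 3 → Fin 4
    paint zero k = inject₁ k
    paint (suc _) k = fromℕ 3

  module _ (col : Col full (λ _ → U)) where
    open Col col
    open Depth (toAdj G)

    private
      bF : Bit (full ∖ I)
      bF = ∖-⊑ full I

      depth : Fin order → Fin 3
      depth = proj₁ (forest-colouring bF forest)

      open Rooted (proj₂ (forest-colouring bF forest))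

      inF : ∀ {x} → I x ≡ 0 → (full ∖ I) x ≡ 1
      inF h = cong (1 ∸_) h

      edge : ∀ {x y} → adj G x y ≡ true → e x y ≡ 1
      edge = cong toℕ₂

    colour : Fin order → Fin 4
    colour x = paint (I x) (depth x)

    private
      I-colour : ∀ {x} → I x ≡ 1 → colour x ≡ fromℕ 3
      I-colour {x} h = cong (λ z → paint z (depth x)) h

      F-colour : ∀ {x} → I x ≡ 0 → colour x ≡ inject₁ (depth x)
      F-colour {x} h = cong (λ z → paint z (depth x)) h

      I≢F : ∀ {x y} → I x ≡ 1 → I y ≡ 0 → colour x ≢ colour y
      I≢F hx hy h = fromℕ≢inject₁ (trans (sym (I-colour hx)) (trans h (F-colour hy)))

      F-same : ∀ {x y} → I x ≡ 0 → I y ≡ 0 → colour x ≡ colour y → depth x ≡ depth y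
      F-same hx hy h = inject₁-injective (trans (sym (F-colour hx)) (trans h (F-colour hy)))

      copy : ∀ {x y k} → colour x ≡ colour y → k ≤ 1 → I x ≡ k → I y ≡ k
      copy {x} {y} h z≤n p = [ (λ q → q) , (λ q → ⊥-elim (I≢F q p (sym h))) ]′ (bit (I⊑V y))
      copy {x} {y} h (s≤s z≤n) p = [ (λ q → ⊥-elim (I≢F p q h)) , (λ q → q) ]′ (bit (I⊑V y))

    colour-proper : Proper colour
    colour-proper x y xy h with bit (I⊑V x)
    ... | inj₂ p = 1≢0 (edge xy) (row≡0 (indep x p) (copy h ≤-refl p))
    ... | inj₁ p = proper x y (inF p) (inF q) (edge xy) (F-same p q h)
      where
      q : I y ≡ 0
      q = copy h z≤n p

    colour-noP₄ : NoP₄ colour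
    colour-noP₄ p q r s pq qr rs pr qs with bit (I⊑V p) | bit (I⊑V q)
    ... | inj₂ hp | _ = inj₁ (unique-neighbour (sparse q refl) hp (copy pr ≤-refl hp) (edge (trans (Graph.sym G q p) pq)) (edge qr))
    ... | inj₁ _ | inj₂ hq = inj₂ (unique-neighbour (sparse r refl) hq (copy qs ≤-refl hq) (edge (trans (Graph.sym G r q) qr)) (edge rs))
    -- All four vertices are in the forest, and `r`, `s` repeat the colours of `p`, `q`. If `p` is a
    -- parent of `q`, so is `r`; otherwise `q` and `s` are both parents of `r`.
    ... | inj₁ hp | inj₁ hq = [ up , down ]′ (rot-cases (depth p) (depth q) (proper p q (inF hp) (inF hq) (edge pq)))
      where
      hr : I r ≡ 0
      hr = copy pr z≤n hp
      hs : I s ≡ 0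
      hs = copy qs z≤n hq
      up : rot (depth p) ≡ depth q → p ≡ r ⊎ q ≡ s
      up h = inj₁ (parent q p r (inF hq) (inF hp) (inF hr) (edge (trans (Graph.sym G q p) pq)) (edge qr) h (trans (cong rot (sym (F-same hp hr pr))) h))
      down : rot (depth q) ≡ depth p → p ≡ r ⊎ q ≡ s
      down h = inj₂ (parent r q s (inF hr) (inF hq) (inF hs) (edge (trans (Graph.sym G r q) qr)) (edge rs) h′ (trans (cong rot (sym (F-same hq hs qs))) h′))
        where
        h′ : rot (depth q) ≡ depth r
        h′ = trans h (F-same hp hr pr)

    colour-nice : Nice colour
    colour-nice = colour-proper , colour-noP₄

theorem1 : (G : Graph) → MadLessFiveHalves G → StarChromaticAtMost G 4
theorem1 G mad = proj₁ found , nice⇒star (proj₂ found)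
  where
  open StarColouring G
  open FromGraph G
  found : ∃ (Nice {4})
  found = nice-stable λ k → colourable (toAdj G) (λ _ → U) (λ _ → ≤-refl) (mad⇒good mad) λ col → k (colour col , colour-nice col)
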